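{- For every $n\ge1$, the polynomial $\mathcal{A}_n(q,t):=\sum_{\sigma\in\mathcal{S}_n(231)}q^{\operatorname{maj}(\sigma)}t^{\binom{n}{2}-\operatorname{imaj}(\sigma)}$ and the $q,t$-Catalan number $\operatorname{Cat}_n(q,t):=\sum_{D\in\mathcal{D}_n}q^{\operatorname{area}(D)}t^{\operatorname{bounce}(D)}$ are related by $$\mathcal{A}_n(q,q^{ -1})=\operatorname{Cat}_n(q,q^{ -1}).$$
   Context: $\mathcal{S}_n$ is the symmetric group on $\{1,\dots,n\}$; $\mathcal{S}_n(231)$ is the set of $\sigma\in\mathcal{S}_n$ with no $i<j<k$ satisfying $\sigma_k<\sigma_i<\sigma_j$. The descent set is $\operatorname{Des}(\sigma)=\{i : 1\le i<n,\ \sigma_i>\sigma_{i+1}\}$, $\operatorname{maj}(\sigma)=\sum_{i\in\operatorname{Des}(\sigma)}i$, and $\operatorname{imaj}(\sigma)=\operatorname{maj}(\sigma^{ -1})$. A Dyck path of semilength $n$ is a word with $n$ letters $0$ (north steps) and $n$ letters $1$ (east steps) such that every prefix contains at least as many $0$'s as $1$'s; $\mathcal{D}_n$ is the set of these. It is identified with a lattice path from $(0,0)$ to $(n,n)$ weakly above the diagonal $x=y$. For $D\in\mathcal{D}_n$ and $1\le y\le n$ let $a_y(D)$ be the number of $1$'s preceding the $y$-th $0$ of $D$ (so $0\le a_y(D)\le y-1$). Then $\operatorname{area}(D)=\sum_{y=1}^n(y-1-a_y(D))$, the number of full lattice squares between $D$ and the diagonal. The bounce statistic is defined by the bounce path which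 starts at $(n,n)$, goes west until it reaches the top of a north step of $D$, then goes south to the diagonal, then again west until the top of a north step of $D$, south to the diagonal, and so on until $(0,0)$; $\operatorname{bounce}(D)$ is the sum of the values $j$ over the points $(j,j)$ with $0<j<n$ at which the bounce path meets the diagonal after a south run. Equivalently: set $j_0=n$ and $j_{i+1}=a_{j_i}(D)$ as long as $j_i>0$; then $\operatorname{bounce}(D)=\sum_{i\ge1}j_i$. -}

module Defs where

open import Algebra.Bundles using (CommutativeRing)
open import Data.Fin.Base as Fin using (Fin; zero; suc; toℕ; inject₁)
open import Data.Fin.Patterns using (0F; 1F)
open import Data.Fin.Permutation as Perm
  using (Permutation′; _⟨$⟩ʳ_; flip; insert; remove)
import Data.Fin.Properties as Fin
open import Data.List.Base
  using (List; []; _∷_; [_]; allFin; cartesianProductWith;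
    filter; foldr; inits; length; map; upTo)
import Data.List.Membership.Setoid as SetoidMembership
import Data.List.Membership.Setoid.Properties as SetoidMembership
open import Data.List.Membership.Propositional.Properties using (∈-allFin)
open import Data.List.Relation.Unary.All using (All; []; all?)
open import Data.List.Relation.Unary.Any using (here)
open import Data.List.Relation.Unary.AllPairs using ([]; _∷_)
import Data.List.Relation.Unary.Unique.Setoid as SetoidUnique
import Data.List.Relation.Unary.Unique.Setoid.Properties as SetoidUnique
open import Data.List.Relation.Unary.Unique.Propositional.Properties using (allFin⁺)
open import Data.Nat.Base using (ℕ; zero; suc; _*_; _∸_; _≤_)
open import Data.Nat.Combinatorics using (_C_)
open import Data.Nat.ListAction using (sum)
open import Data.Nat.Properties using (_≟_; _≤?_)
open import Data.Product.Base using (_×_; _,_)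
open import Level using (0ℓ)
open import Relation.Binary.Bundles using (Setoid)
open import Relation.Binary.PropositionalEquality
  using (_≡_; refl; sym; trans; cong; setoid)
open import Relation.Nullary using (Dec; ¬_)
open import Relation.Nullary.Decidable using (_×-dec_; _→-dec_; ¬?)

------------------------------------------------------------------------
-- Permutations

-- A permutation of {1,…,n} is a bijection of Fin n, with i : Fin n
-- standing for the number suc (toℕ i).

permutations : (n : ℕ) → List (Permutation′ n)
permutations zero    = [ Perm.id ]
permutations (suc n) =
  cartesianProductWith (insert 0F) (allFin (suc n)) (permutations n)

-- Every permutation occurs in this list exactly once, up to pointwise
-- equality.

permutationSetoid : ℕ → Setoid 0ℓ 0ℓ
permutationSetoid n = record
  { Carrier       = Permutation′ n
  ; _≈_           = Perm._≈_
  ; isEquivalence = record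
    { refl  = λ _ → refl
    ; sym   = λ p i → sym (p i)
    ; trans = λ p q i → trans (p i) (q i)
    }
  }

insert-cong : ∀ {n} {i j : Fin (suc n)} {π ρ : Permutation′ n} →
              i ≡ j → π Perm.≈ ρ → insert 0F i π Perm.≈ insert 0F j ρ
insert-cong         refl p zero    = refl
insert-cong {i = i} refl p (suc k) = cong (Fin.punchIn i) (p k)

insert-injective : ∀ {n} (i j : Fin (suc n)) (π ρ : Permutation′ n) →
                   insert 0F i π Perm.≈ insert 0F j ρ → i ≡ j × π Perm.≈ ρ
insert-injective i j π ρ p with refl ← p zero =
  refl , λ k → Fin.punchIn-injective i (π ⟨$⟩ʳ k) (ρ ⟨$⟩ʳ k) (p (suc k))

permutations-complete : ∀ n (π : Permutation′ n) →
  SetoidMembership._∈_ (permutationSetoid n) π (permutations n)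
permutations-complete zero    π = here λ ()
permutations-complete (suc n) π =
  SetoidMembership.∈-resp-≈ (permutationSetoid (suc n))
    {x = insert 0F (π ⟨$⟩ʳ 0F) (remove 0F π)} {y = π} (Perm.insert-remove 0F π)
    (SetoidMembership.∈-cartesianProductWith⁺
      (setoid _) (permutationSetoid n) (permutationSetoid (suc n))
      (λ {i} {j} {π} {ρ} → insert-cong {π = π} {ρ = ρ})
      (∈-allFin (π ⟨$⟩ʳ 0F))
      (permutations-complete n (remove 0F π)))

permutations-unique : ∀ n → SetoidUnique.Unique (permutationSetoid n) (permutations n)
permutations-unique zero    = [] ∷ []
permutations-unique (suc n) =
  SetoidUnique.cartesianProductWith⁺
    (setoid _) (permutationSetoid n) (permutationSetoid (suc n))
    (insert 0F) (λ {i} {j} {π} {ρ} → insert-injective i j π ρ)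
    (allFin⁺ (suc n)) (permutations-unique n)

Avoids231 : ∀ {n} → Permutation′ n → Set
Avoids231 σ = ∀ i j k → i Fin.< j → j Fin.< k →
  ¬ ((σ ⟨$⟩ʳ k) Fin.< (σ ⟨$⟩ʳ i) × (σ ⟨$⟩ʳ i) Fin.< (σ ⟨$⟩ʳ j))

avoids231? : ∀ {n} (σ : Permutation′ n) → Dec (Avoids231 σ)
avoids231? σ = Fin.all? λ i → Fin.all? λ j → Fin.all? λ k →
  (i Fin.<? j) →-dec ((j Fin.<? k) →-dec
    ¬? (((σ ⟨$⟩ʳ k) Fin.<? (σ ⟨$⟩ʳ i)) ×-dec ((σ ⟨$⟩ʳ i) Fin.<? (σ ⟨$⟩ʳ j))))

𝒮231 : (n : ℕ) → List (Permutation′ n)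
𝒮231 n = filter avoids231? (permutations n)

-- The descents are listed as elements of {1,…,n-1}: for i : Fin m, the
-- positions inject₁ i and suc i are the i'-th and the (i'+1)-st of
-- {1,…,m+1}, where i' = suc (toℕ i).
Des : ∀ {n} → Permutation′ n → List ℕ
Des {zero}  σ = []
Des {suc m} σ = map (λ i → suc (toℕ i))
  (filter (λ i → (σ ⟨$⟩ʳ suc i) Fin.<? (σ ⟨$⟩ʳ inject₁ i)) (allFin m))

maj : ∀ {n} → Permutation′ n → ℕ
maj σ = sum (Des σ)

imaj : ∀ {n} → Permutation′ n → ℕ
imaj σ = maj (flip σ)

------------------------------------------------------------------------
-- Dyck paths

-- Words in the letters 0 (north step) and 1 (east step).
Word : Set
Word = List (Fin 2)

#0 #1 : Word → ℕ
#0 w = length (filter (Fin._≟ 0F) w)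
#1 w = length (filter (Fin._≟ 1F) w)

IsDyck : ℕ → Word → Set
IsDyck n w = #0 w ≡ n × #1 w ≡ n × All (λ p → #1 p ≤ #0 p) (inits w)

isDyck? : ∀ n w → Dec (IsDyck n w)
isDyck? n w = (#0 w ≟ n) ×-dec ((#1 w ≟ n) ×-dec all? (λ p → #1 p ≤? #0 p) (inits w))

-- All words of a given length.
words : ℕ → List Word
words zero    = [ [] ]
words (suc k) = cartesianProductWith _∷_ (allFin 2) (words k)

𝒟 : ℕ → List Word
𝒟 n = filter (isDyck? n) (words (2 * n))

-- a w y is the number of 1's preceding the y-th 0 of w, for 1 ≤ y ≤ #0 w.
-- Outside this range only the value a w 0 = 0 matters: see bounce.
a : Word → ℕ → ℕ
a w        zero          = 0
a []       (suc y)       = 0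
a (0F ∷ w) (suc zero)    = 0
a (0F ∷ w) (suc (suc y)) = a w (suc y)
a (1F ∷ w) (suc y)       = suc (a w (suc y))

-- The summand for i is that of the row y = i + 1, so y - 1 = i.  On a
-- Dyck word a w y ≤ y - 1, and the subtraction is not truncated.
area : ℕ → Word → ℕ
area n w = sum (map (λ i → i ∸ a w (suc i)) (upTo n))

-- The bounce path meets the diagonal at (j₀,j₀), (j₁,j₁), …: going west
-- from (j,j) it reaches the top of the j-th north step, whose abscissa
-- is a w j.
bouncePoint : ℕ → Word → ℕ → ℕ
bouncePoint n w zero    = n
bouncePoint n w (suc i) = a w (bouncePoint n w i)

-- The sum of j₁, …, jₙ.  On a Dyck word the sequence decreases strictly
-- until it reaches 0, hence jᵢ = 0 for all i ≥ n, and the terms after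
-- the first 0 contribute nothing because a w 0 = 0.
bounce : ℕ → Word → ℕ
bounce n w = sum (map (λ i → bouncePoint n w (suc i)) (upTo n))

------------------------------------------------------------------------
-- The two polynomials, as polynomial functions of two elements q and t
-- of an arbitrary commutative ring.

module _ {c ℓ} (R : CommutativeRing c ℓ) where
  open CommutativeRing R using (Carrier; _+_; 0#; semiring) renaming (_*_ to _·_)
  open import Algebra.Properties.Semiring.Exp semiring using (_^_)

  sumOver : ∀ {A : Set} → List A → (A → Carrier) → Carrier
  sumOver xs f = foldr _+_ 0# (map f xs)

  -- imaj σ ≤ n C 2 always, so the subtraction is not truncated.
  𝒜 : ℕ → Carrier → Carrier → Carrier
  𝒜 n q t = sumOver (𝒮231 n) λ σ → (q ^ maj σ) · (t ^ (n C 2 ∸ imaj σ))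

  Cat : ℕ → Carrier → Carrier → Carrier
  Cat n q t = sumOver (𝒟 n) λ D → (q ^ area n D) · (t ^ bounce n D)

{-# OPTIONS --safe #-}
module Submission where

-- Put z = q⁻¹.  Both sides are q ^ (n C 2) times the same polynomial in z,
-- namely H n 1 = [2n choose n] - z [2n choose n-1], with Gaussian binomial
-- coefficients in z.  This is the q-Catalan number of MacMahon.
--
-- Permutations.  The descents and the ascents of a permutation together are
-- all positions 1, …, n-1, so maj σ is n C 2 minus the sum of the ascent
-- positions, and likewise for σ⁻¹.  Thus 𝒜 is q ^ (n C 2) times the sum of
-- z ^ (ascent positions of σ and of σ⁻¹) over the 231-avoiding σ.  In a
-- 231-avoiding permutation with p values below the initial one, those p
-- values come next, and are followed by the larger ones; both blocks are
-- again 231-avoiding (avoids231-insert, sumCodes-split).  The ascent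
-- positions of σ and σ⁻¹ then add up (weight-block) in the same way as the
-- valley positions of a Dyck word 0 D 1 D′ (first-return).  So the sum is the
-- generating function of the Dyck words by the major index
-- (avoiderSum≈dyck-≤).  Removing the last step of a ballot path instead of
-- decomposing at the first return evaluates it (ballot-closed, dyck-closed).
--
-- Dyck paths.  The area is n C 2 minus the sum of the a_y, so Cat is
-- q ^ (n C 2) times the sum of z ^ (Σ a_y + bounce).  Removing the last step
-- of a ballot path gives a recursion in which the next row of the bounce path
-- is remembered.  Its solution (bounceSum-closed) is a convolution of Gaussian
-- coefficients with the polynomials H.  When complete, this convolution is
-- itself a value of H, by the q-Vandermonde identity (H-recursion).

open import Defs
open import Algebra.Bundles using (CommutativeRing)
open import Data.Bool.Base using (Bool; true; false; _∧_; if_then_else_; T)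
open import Data.Bool.Properties using (∧-assoc; T-∧)
open import Data.Fin.Base as Fin using (Fin; toℕ; inject₁; punchIn)
open import Data.Fin.Patterns using (0F; 1F)
open import Data.Fin.Permutation as Perm using (Permutation′; _⟨$⟩ʳ_; _⟨$⟩ˡ_; flip; insert)
import Data.Fin.Properties as Fin
open import Data.List.Base
  using (List; []; _∷_; [_]; _++_; _∷ʳ_; allFin; cartesianProductWith; filter; inits;
    length; map; tabulate; upTo)
open import Data.List.Properties
  using (++-identityʳ; length-++; length-map; map-++; map-applyUpTo; map-cong;
    map-cong-local; map-id; map-tabulate; map-upTo; map-∘; tabulate-cong; upTo-∷ʳ)
open import Data.List.Relation.Unary.All as All using (All; []; _∷_; all?)
import Data.List.Relation.Unary.All.Properties as All
open import Data.Nat.Base as ℕ using (ℕ; zero; suc; _≤_; _<_; z≤n; s≤s; s≤s⁻¹; _<ᵇ_; _∸_)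
open import Data.Nat.Combinatorics using (_C_; nCk+nC[k+1]≡[n+1]C[k+1]; nC1≡n)
open import Data.Nat.ListAction using (sum)
open import Data.Nat.ListAction.Properties using (sum-++)
import Data.Nat.Properties as ℕ
import Data.Nat.Tactic.RingSolver as NS
open import Data.Product.Base using (_×_; _,_; proj₁)
open import Data.Sum.Base using (inj₁; inj₂)
open import Data.Unit.Base using (tt)
open import Function.Base using (_∘_; id)
open import Function.Bundles using (_⇔_; mk⇔; Equivalence)
open import Relation.Binary.Definitions using (tri<; tri≈; tri>)
open import Relation.Binary.PropositionalEquality as ≡ using (_≡_; _≢_)
open import Relation.Nullary using (Dec; ¬_; yes; no; does; contradiction)
open import Relation.Nullary.Decidable using (_×-dec_; dec-false; does-⇔; T?)

-- Finite convolution sums in a commutative ring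
module Sums {c ℓ} (R : CommutativeRing c ℓ) where
  open CommutativeRing R hiding (zero)
  open import Algebra.Properties.Ring ring using (-‿+-comm)
  open import Relation.Binary.Reasoning.Setoid setoid

  open import Algebra.Solver.Ring.NaturalCoefficients.Default commutativeSemiring public
    using (solve; con; _:+_; _:*_; _:=_)

  -- conv n f is the sum of f s t over all s and t with s + t = n.
  conv : ℕ → (ℕ → ℕ → Carrier) → Carrier
  conv zero    f = f 0 0
  conv (suc n) f = f 0 (suc n) + conv n (λ s t → f (suc s) t)

  conv-cong : ∀ n {f g : ℕ → ℕ → Carrier} →
              (∀ s t → s ℕ.+ t ≡ n → f s t ≈ g s t) → conv n f ≈ conv n g
  conv-cong zero    p = p 0 0 ≡.refl
  conv-cong (suc n) p =
    +-cong (p 0 (suc n) ≡.refl) (conv-cong n λ s t e → p (suc s) t (≡.cong suc e))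

  conv-last : ∀ n (f : ℕ → ℕ → Carrier) →
              conv (suc n) f ≈ conv n (λ s t → f s (suc t)) + f (suc n) 0
  conv-last zero    f = refl
  conv-last (suc n) f =
    trans (+-congˡ (conv-last n (λ s t → f (suc s) t))) (sym (+-assoc _ _ _))

  interchange : ∀ w x y z → (w + x) + (y + z) ≈ (w + y) + (x + z)
  interchange = solve 4 (λ w x y z → ((w :+ x) :+ (y :+ z)) := ((w :+ y) :+ (x :+ z))) refl

  conv-+ : ∀ n (f g : ℕ → ℕ → Carrier) →
           conv n (λ s t → f s t + g s t) ≈ conv n f + conv n g
  conv-+ zero    f g = refl
  conv-+ (suc n) f g = trans (+-congˡ (conv-+ n _ _)) (interchange _ _ _ _)

  conv-* : ∀ n x (f : ℕ → ℕ → Carrier) → conv n (λ s t → x * f s t) ≈ x * conv n f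
  conv-* zero    x f = refl
  conv-* (suc n) x f = trans (+-congˡ (conv-* n x _)) (sym (distribˡ x _ _))

  conv-neg : ∀ n (f : ℕ → ℕ → Carrier) → conv n (λ s t → - f s t) ≈ - conv n f
  conv-neg zero    f = refl
  conv-neg (suc n) f = trans (+-congˡ (conv-neg n _)) (-‿+-comm _ _)

  conv-0 : ∀ n → conv n (λ _ _ → 0#) ≈ 0#
  conv-0 zero    = refl
  conv-0 (suc n) = trans (+-identityˡ _) (conv-0 n)

  -- Both sides sum f s t u over s + t + u = n.
  conv-assoc : ∀ n (f : ℕ → ℕ → ℕ → Carrier) →
    conv n (λ s t → conv t (f s)) ≈ conv n (λ r u → conv r (λ s t → f s t u))
  conv-assoc zero    f = refl
  conv-assoc (suc n) f = begin
    (f 0 0 (suc n) + conv n (λ r u → f 0 (suc r) u)) + conv n (λ s t → conv t (f (suc s)))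
      ≈⟨ +-assoc _ _ _ ⟩
    f 0 0 (suc n) + (conv n (λ r u → f 0 (suc r) u) + conv n (λ s t → conv t (f (suc s))))
      ≈⟨ +-congˡ (+-congˡ (conv-assoc n (λ s → f (suc s)))) ⟩
    f 0 0 (suc n) + (conv n (λ r u → f 0 (suc r) u)
                     + conv n (λ r u → conv r (λ s t → f (suc s) t u)))
      ≈⟨ +-congˡ (conv-+ n _ _) ⟨
    f 0 0 (suc n) + conv n (λ r u → f 0 (suc r) u + conv r (λ s t → f (suc s) t u)) ∎

-- Gaussian binomial coefficients in z
module Gauss {c ℓ} (R : CommutativeRing c ℓ) (z : CommutativeRing.Carrier R) where
  open CommutativeRing R hiding (zero)
  open Sums R
  open import Algebra.Properties.Semiring.Exp semiring using (_^_; ^-homo-*; ^-congʳ)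
  open import Algebra.Properties.Ring ring using (-‿distribʳ-*)
  open import Relation.Binary.Reasoning.Setoid setoid

  infix 9 z^_
  z^_ : ℕ → Carrier
  z^ n = z ^ n

  z^+ : ∀ m n → z^ (m ℕ.+ n) ≈ z^ m * z^ n
  z^+ = ^-homo-* z

  z^≡ : ∀ {m n} → m ≡ n → z^ m ≈ z^ n
  z^≡ = ^-congʳ z

  -- As z is the inverse of q, a missing factor q ^ k can be traded for z ^ k.
  z^-complement : ∀ {q} → q * z ≈ 1# → ∀ m k → q ^ m ≈ q ^ (m ℕ.+ k) * z^ k
  z^-complement {q} qz m k = begin
    q ^ m                      ≈⟨ *-identityʳ _ ⟨
    q ^ m * 1#                 ≈⟨ *-congˡ (cancel k) ⟨
    q ^ m * (q ^ k * z^ k)    ≈⟨ *-assoc _ _ _ ⟨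
    q ^ m * q ^ k * z^ k      ≈⟨ *-congʳ (^-homo-* q m k) ⟨
    q ^ (m ℕ.+ k) * z^ k       ∎
    where
    cancel : ∀ k → q ^ k * z^ k ≈ 1#
    cancel zero    = *-identityˡ _
    cancel (suc k) = begin
      (q * q ^ k) * (z * z^ k) ≈⟨ solve 4 (λ q a z b → (q :* a) :* (z :* b) := (q :* z) :* (a :* b)) refl q _ z _ ⟩
      (q * z) * (q ^ k * z^ k) ≈⟨ *-cong qz (cancel k) ⟩
      1# * 1#                   ≈⟨ *-identityˡ _ ⟩
      1#                        ∎

  -- g a b is the Gaussian binomial coefficient [a + b choose b] in z, the
  -- generating function of the partitions inside an a × b box by size.  It is
  -- defined by one of the two Pascal rules; pascal₂ is the other.
  g : ℕ → ℕ → Carrier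
  g zero    b       = 1#
  g (suc a) zero    = 1#
  g (suc a) (suc b) = g a (suc b) + z^ (suc a) * g (suc a) b

  g-zeroʳ : ∀ a → g a 0 ≈ 1#
  g-zeroʳ zero    = refl
  g-zeroʳ (suc a) = refl

  pascal₂ : ∀ a b → g (suc a) (suc b) ≈ z^ (suc b) * g a (suc b) + g (suc a) b
  pascal₂ zero zero    = begin
    1# + z * 1# * 1#   ≈⟨ lem z ⟩
    z * 1# * 1# + 1#   ∎
    where
    lem : ∀ x → 1# + x * 1# * 1# ≈ x * 1# * 1# + 1#
    lem = solve 1 (λ x → (con 1 :+ x :* con 1 :* con 1) := (x :* con 1 :* con 1 :+ con 1)) refl
  pascal₂ zero (suc b) = begin
    1# + z * 1# * g 1 (suc b)    ≈⟨ +-congˡ (*-congˡ (pascal₂ zero b)) ⟩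
    1# + z * 1# * (z^ (suc b) * 1# + g 1 b)  ≈⟨ lem z (z^ (suc b)) (g 1 b) ⟩
    z * z^ (suc b) * 1# + (1# + z * 1# * g 1 b) ∎
    where
    lem : ∀ x y w → 1# + x * 1# * (y * 1# + w) ≈ x * y * 1# + (1# + x * 1# * w)
    lem = solve 3 (λ x y w → (con 1 :+ x :* con 1 :* (y :* con 1 :+ w)) := (x :* y :* con 1 :+ (con 1 :+ x :* con 1 :* w))) refl
  pascal₂ (suc a) zero = begin
    g (suc a) 1 + z^ (2 ℕ.+ a) * 1#       ≈⟨ +-congʳ (pascal₂ a zero) ⟩
    (z^ 1 * g a 1 + g (suc a) 0) + z^ (2 ℕ.+ a) * 1#  ≈⟨ lem z (g a 1) (z^ (suc a)) ⟩
    z^ 1 * (g a 1 + z^ (suc a) * 1#) + 1# ∎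
    where
    lem : ∀ x y w → (x * 1# * y + 1#) + x * w * 1# ≈ x * 1# * (y + w * 1#) + 1#
    lem = solve 3 (λ x y w → ((x :* con 1 :* y :+ con 1) :+ x :* w :* con 1) := (x :* con 1 :* (y :+ w :* con 1) :+ con 1)) refl
  pascal₂ (suc a) (suc b) = begin
    g (suc a) (2 ℕ.+ b) + z^ (2 ℕ.+ a) * g (2 ℕ.+ a) (suc b)
      ≈⟨ +-cong (pascal₂ a (suc b)) (*-congˡ (pascal₂ (suc a) b)) ⟩
    (z^ (2 ℕ.+ b) * g a (2 ℕ.+ b) + g (suc a) (suc b))
      + z^ (2 ℕ.+ a) * (z^ (suc b) * g (suc a) (suc b) + g (2 ℕ.+ a) b)
      ≈⟨ lem z (z^ (suc a)) (z^ (suc b)) (g a (2 ℕ.+ b)) (g (suc a) (suc b)) (g (2 ℕ.+ a) b) ⟩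
    z^ (2 ℕ.+ b) * (g a (2 ℕ.+ b) + z^ (suc a) * g (suc a) (suc b))
      + (g (suc a) (suc b) + z^ (2 ℕ.+ a) * g (2 ℕ.+ a) b) ∎
    where
    lem : ∀ x p q u v w → (x * q * u + v) + x * p * (q * v + w) ≈ x * q * (u + p * v) + (v + x * p * w)
    lem = solve 6 (λ x p q u v w → ((x :* q :* u :+ v) :+ x :* p :* (q :* v :+ w)) := (x :* q :* (u :+ p :* v) :+ (v :+ x :* p :* w))) refl

  g-sym : ∀ a b → g a b ≈ g b a
  g-sym zero    b       = sym (g-zeroʳ b)
  g-sym (suc a) zero    = refl
  g-sym (suc a) (suc b) = begin
    g a (suc b) + z^ (suc a) * g (suc a) b  ≈⟨ +-cong (g-sym a (suc b)) (*-congˡ (g-sym (suc a) b)) ⟩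
    g (suc b) a + z^ (suc a) * g b (suc a)  ≈⟨ +-comm _ _ ⟩
    z^ (suc a) * g b (suc a) + g (suc b) a  ≈⟨ pascal₂ b a ⟨
    g (suc b) (suc a)                       ∎

  g-≡ : ∀ {a a′} b → a ≡ a′ → g a b ≈ g a′ b
  g-≡ b e = reflexive (≡.cong (λ a → g a b) e)

  -- The partitions inside an (a + b + 1) × (s + t) box whose row a + 1 has length
  -- s: a filled rectangle, an a × t box beside it and a b × s box below it.
  vandTerm : ℕ → ℕ → ℕ → ℕ → Carrier
  vandTerm a b s t = z^ (suc a ℕ.* s) * (g a t * g b s)

  vandTerm-zero : ∀ a b t → vandTerm a b 0 t ≈ g a t
  vandTerm-zero a b t = begin
    z^ (suc a ℕ.* 0) * (g a t * g b 0) ≈⟨ *-cong (z^≡ (ℕ.*-zeroʳ (suc a))) (*-congˡ (g-zeroʳ b)) ⟩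
    1# * (g a t * 1#)                  ≈⟨ solve 1 (λ x → con 1 :* (x :* con 1) := x) refl (g a t) ⟩
    g a t                              ∎

  -- The q-Vandermonde identity, sorting the partitions inside an
  -- (a + b + 1) × n box by the length of row a + 1.
  vandermonde : ∀ a b n → conv n (vandTerm a b) ≈ g (suc (a ℕ.+ b)) n
  vandermonde a    b zero = trans (vandTerm-zero a b 0) (g-zeroʳ a)
  vandermonde zero b (suc n) = begin
    conv (suc n) (vandTerm 0 b)                      ≈⟨ conv-last n (vandTerm 0 b) ⟩
    conv n (vandTerm 0 b) + vandTerm 0 b (suc n) 0
      ≈⟨ +-cong (vandermonde 0 b n)
                (*-cong (z^≡ (ℕ.*-identityˡ (suc n))) (*-identityˡ (g b (suc n)))) ⟩
    g (suc b) n + z^ (suc n) * g b (suc n)           ≈⟨ +-comm _ _ ⟩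
    z^ (suc n) * g b (suc n) + g (suc b) n           ≈⟨ pascal₂ b n ⟨
    g (suc b) (suc n)                                ∎
  vandermonde (suc a) b (suc n) = begin
    conv (suc n) F′                                    ≈⟨ conv-last n F′ ⟩
    conv n (λ s t → F′ s (suc t)) + F′ (suc n) 0       ≈⟨ +-cong (conv-cong n step) top ⟩
    conv n (λ s t → zⁿ * F s (suc t) + F′ s t) + zⁿ * F (suc n) 0
      ≈⟨ +-congʳ (trans (conv-+ n _ _) (+-congʳ (conv-* n zⁿ _))) ⟩
    (zⁿ * conv n (λ s t → F s (suc t)) + conv n F′) + zⁿ * F (suc n) 0
      ≈⟨ solve 4 (λ x p q r → (x :* p :+ q) :+ x :* r := x :* (p :+ r) :+ q) refl
           zⁿ (conv n (λ s t → F s (suc t))) (conv n F′) (F (suc n) 0) ⟩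
    zⁿ * (conv n (λ s t → F s (suc t)) + F (suc n) 0) + conv n F′
      ≈⟨ +-congʳ (*-congˡ (conv-last n F)) ⟨
    zⁿ * conv (suc n) F + conv n F′
      ≈⟨ +-cong (*-congˡ (vandermonde a b (suc n))) (vandermonde (suc a) b n) ⟩
    zⁿ * g (suc (a ℕ.+ b)) (suc n) + g (2 ℕ.+ (a ℕ.+ b)) n
      ≈⟨ pascal₂ (suc (a ℕ.+ b)) n ⟨
    g (2 ℕ.+ (a ℕ.+ b)) (suc n)                        ∎
    where
    F F′ : ℕ → ℕ → Carrier
    F  = vandTerm a b
    F′ = vandTerm (suc a) b
    zⁿ : Carrier
    zⁿ = z^ (suc n)

    expo : ∀ s t → suc (s ℕ.+ t) ℕ.+ suc a ℕ.* s ≡ (2 ℕ.+ a) ℕ.* s ℕ.+ suc t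
    expo = λ s t → lem s t a
      where
      lem : ∀ s t a → suc (s ℕ.+ t) ℕ.+ suc a ℕ.* s ≡ (2 ℕ.+ a) ℕ.* s ℕ.+ suc t
      lem = NS.solve-∀

    zⁿ-shift : ∀ s t → s ℕ.+ t ≡ n → zⁿ * z^ (suc a ℕ.* s) ≈ z^ ((2 ℕ.+ a) ℕ.* s) * z^ (suc t)
    zⁿ-shift s t ≡.refl =
      trans (sym (z^+ (suc n) (suc a ℕ.* s)))
        (trans (z^≡ (expo s t)) (z^+ ((2 ℕ.+ a) ℕ.* s) (suc t)))

    step : ∀ s t → s ℕ.+ t ≡ n → F′ s (suc t) ≈ zⁿ * F s (suc t) + F′ s t
    step s t e = begin
      w * (g (suc a) (suc t) * y)                    ≈⟨ *-congˡ (*-congʳ (pascal₂ a t)) ⟩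
      w * ((z^ (suc t) * g a (suc t) + g (suc a) t) * y)
        ≈⟨ solve 5 (λ w p q r y → w :* ((p :* q :+ r) :* y) := (w :* p) :* (q :* y) :+ w :* (r :* y)) refl
             w (z^ (suc t)) (g a (suc t)) (g (suc a) t) y ⟩
      (w * z^ (suc t)) * (g a (suc t) * y) + F′ s t  ≈⟨ +-congʳ (*-congʳ (zⁿ-shift s t e)) ⟨
      (zⁿ * z^ (suc a ℕ.* s)) * (g a (suc t) * y) + F′ s t ≈⟨ +-congʳ (*-assoc _ _ _) ⟩
      zⁿ * F s (suc t) + F′ s t                      ∎
      where
      w y : Carrier
      w = z^ ((2 ℕ.+ a) ℕ.* s)
      y = g b s

    top : F′ (suc n) 0 ≈ zⁿ * F (suc n) 0
    top = begin
      z^ ((2 ℕ.+ a) ℕ.* suc n) * (1# * g b (suc n))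
        ≈⟨ *-cong (z^+ (suc n) (suc a ℕ.* suc n)) (*-congʳ (sym (g-zeroʳ a))) ⟩
      (zⁿ * z^ (suc a ℕ.* suc n)) * (g a 0 * g b (suc n)) ≈⟨ *-assoc _ _ _ ⟩
      zⁿ * F (suc n) 0                               ∎

  -- H m k = [2m + k - 1 choose m] - z ^ k [2m + k - 1 choose m - 1], a z-analogue
  -- of the ballot number k / (m + k) (2m + k - 1 choose m).
  H : ℕ → ℕ → Carrier
  H zero    k = 1#
  H (suc m) k = g (m ℕ.+ k) (suc m) + z^ k * - g (suc (m ℕ.+ k)) m

  -- The ballot number k / (m + k) (2m + k - 1 choose m) vanishes for k = 0 < m, while
  -- H 0 0 = 1.
  H-zero : ∀ m → H (suc m) 0 ≈ 0#
  H-zero m = begin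
    g (m ℕ.+ 0) (suc m) + 1# * - g (suc (m ℕ.+ 0)) m
      ≈⟨ +-cong (g-≡ (suc m) (ℕ.+-identityʳ m))
                (trans (*-identityˡ _) (-‿cong (g-≡ m (≡.cong suc (ℕ.+-identityʳ m))))) ⟩
    g m (suc m) + - g (suc m) m   ≈⟨ +-congʳ (g-sym m (suc m)) ⟩
    g (suc m) m + - g (suc m) m   ≈⟨ -‿inverseʳ _ ⟩
    0#                            ∎

  -- The factor z ^ k of the second term of H disappears.  This compares the two
  -- Pascal rules for [2s + k + 2 choose s + 1].
  z^*H : ∀ s k → z^ (suc s) * H (suc s) k ≈ g (s ℕ.+ k) (suc s) + - g (suc (s ℕ.+ k)) s
  z^*H s k = begin
    P * (A + K * - B)                       ≈⟨ trans (+-congˡ (-‿inverseʳ B)) (+-identityʳ _) ⟨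
    P * (A + K * - B) + (B + - B)
      ≈⟨ solve 5 (λ p a k b b′ → p :* (a :+ k :* b′) :+ (b :+ b′) := (p :* a :+ b) :+ p :* k :* b′ :+ b′)
           refl P A K B (- B) ⟩
    (P * A + B) + P * K * - B + - B         ≈⟨ +-congʳ (+-congʳ (pascal₂ (s ℕ.+ k) s)) ⟨
    (A + z^ (suc (s ℕ.+ k)) * B) + P * K * - B + - B
      ≈⟨ +-congʳ (+-congʳ (+-congˡ (*-congʳ (z^+ (suc s) k)))) ⟩
    (A + P * K * B) + P * K * - B + - B
      ≈⟨ solve 4 (λ a c b b′ → (a :+ c :* b) :+ c :* b′ :+ b′ := c :* (b :+ b′) :+ (a :+ b′))
           refl A (P * K) B (- B) ⟩
    P * K * (B + - B) + (A + - B)           ≈⟨ +-congʳ (trans (*-congˡ (-‿inverseʳ B)) (zeroʳ _)) ⟩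
    0# + (A + - B)                          ≈⟨ +-identityˡ _ ⟩
    A + - B                                 ∎
    where
    P K A B : Carrier
    P = z^ (suc s)
    K = z^ k
    A = g (s ℕ.+ k) (suc s)
    B = g (suc (s ℕ.+ k)) s

  -- By z^*H the sum splits into two complete Vandermonde sums, whose values are
  -- the two terms of H m (k + 1).
  H-recursion : ∀ m k → conv m (λ s t → z^ ((2 ℕ.+ k) ℕ.* s) * (g k t * H s t)) ≈ H m (suc k)
  H-recursion zero k = begin
    z^ ((2 ℕ.+ k) ℕ.* 0) * (g k 0 * 1#)
      ≈⟨ *-cong (z^≡ (ℕ.*-zeroʳ (2 ℕ.+ k))) (*-congʳ (g-zeroʳ k)) ⟩
    1# * (1# * 1#)   ≈⟨ solve 0 (con 1 :* (con 1 :* con 1) := con 1) refl ⟩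
    1#               ∎
  H-recursion (suc m) k = begin
    z^ ((2 ℕ.+ k) ℕ.* 0) * (g k (suc m) * 1#) + conv m (λ s t → z^ ((2 ℕ.+ k) ℕ.* suc s) * (g k t * H (suc s) t))
      ≈⟨ +-cong first (conv-cong m step) ⟩
    V 0 (suc m) + conv m (λ s t → V (suc s) t + K * - V′ s t)
      ≈⟨ +-congˡ (conv-+ m _ _) ⟩
    V 0 (suc m) + (conv m (λ s t → V (suc s) t) + conv m (λ s t → K * - V′ s t))
      ≈⟨ +-assoc _ _ _ ⟨
    conv (suc m) V + conv m (λ s t → K * - V′ s t)
      ≈⟨ +-cong (vandermonde k m (suc m)) (trans (conv-* m K _) (*-congˡ (trans (conv-neg m V′) (-‿cong (vandermonde k (suc m) m))))) ⟩
    g (suc (k ℕ.+ m)) (suc m) + K * - g (suc (k ℕ.+ suc m)) m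
      ≈⟨ +-cong (g-≡ (suc m) (≡.trans (≡.sym (ℕ.+-suc k m)) (ℕ.+-comm k (suc m)) )) refl ⟩
    g (suc m ℕ.+ k) (suc m) + K * - g (suc (k ℕ.+ suc m)) m
      ≈⟨ +-cong (g-≡ (suc m) (≡.sym (ℕ.+-suc m k)))
           (*-congˡ (-‿cong (g-≡ m (≡.cong suc (≡.trans (ℕ.+-comm k (suc m)) (≡.sym (ℕ.+-suc m k))))))) ⟩
    g (m ℕ.+ suc k) (suc m) + K * - g (suc (m ℕ.+ suc k)) m ∎
    where
    K : Carrier
    K = z^ (suc k)
    V V′ : ℕ → ℕ → Carrier
    V  = vandTerm k m
    V′ = vandTerm k (suc m)

    first : z^ ((2 ℕ.+ k) ℕ.* 0) * (g k (suc m) * 1#) ≈ V 0 (suc m)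
    first = *-cong (z^≡ (≡.trans (ℕ.*-zeroʳ (2 ℕ.+ k)) (≡.sym (ℕ.*-zeroʳ (suc k))))) (*-congˡ (sym (g-zeroʳ m)))

    step : ∀ s t → s ℕ.+ t ≡ m → z^ ((2 ℕ.+ k) ℕ.* suc s) * (g k t * H (suc s) t) ≈ V (suc s) t + K * - V′ s t
    step s t ≡.refl = begin
      z^ ((2 ℕ.+ k) ℕ.* suc s) * (G * H (suc s) t)   ≈⟨ *-congʳ (z^+ (suc s) (suc k ℕ.* suc s)) ⟩
      (z^ (suc s) * X) * (G * H (suc s) t)
        ≈⟨ solve 4 (λ p x g h → (p :* x) :* (g :* h) := x :* (g :* (p :* h))) refl (z^ (suc s)) X G (H (suc s) t) ⟩
      X * (G * (z^ (suc s) * H (suc s) t))           ≈⟨ *-congˡ (*-congˡ (z^*H s t)) ⟩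
      X * (G * (A + - B))                            ≈⟨ solve 4 (λ x g a b → x :* (g :* (a :+ b)) := x :* (g :* a) :+ x :* (g :* b)) refl X G A (- B) ⟩
      V (suc s) t + X * (G * - B)                    ≈⟨ +-congˡ (*-cong (trans (z^≡ (ℕ.*-suc (suc k) s)) (z^+ (suc k) (suc k ℕ.* s))) (sym (-‿distribʳ-* G B))) ⟩
      V (suc s) t + (K * Y) * - (G * B)              ≈⟨ +-congˡ (trans (*-assoc _ _ _) (*-congˡ (sym (-‿distribʳ-* Y (G * B))))) ⟩
      V (suc s) t + K * - V′ s t                     ∎
      where
      X Y G A B : Carrier
      X = z^ (suc k ℕ.* suc s)
      Y = z^ (suc k ℕ.* s)
      G = g k t
      A = g (s ℕ.+ t) (suc s)
      B = g (suc (s ℕ.+ t)) s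

-- Ballot paths by the major index
module Paths {c ℓ} (R : CommutativeRing c ℓ) (z : CommutativeRing.Carrier R) where
  open CommutativeRing R hiding (zero)
  open Sums R
  open Gauss R z
  open import Algebra.Properties.Ring ring using (-‿+-comm; -‿distribʳ-*)
  open import Relation.Binary.Reasoning.Setoid setoid

  -- The weight attached to the end of a path, as a function of its last letter
  -- (true for an east step) and of the number of letters read.
  End : Set c
  End = Bool → ℕ → Carrier

  -- The factor of a north step that has i letters before it.  After an east step
  -- it completes a descent 10 of the word at position i.
  turn : Bool → ℕ → Carrier
  turn true  i = z^ i
  turn false i = 1#

  -- paths e b h k l i sums the weights of the words with k north and l east steps
  -- which, started at height h, never go below height 0.  The weight is the product
  -- of the factors turn and of the end weight e; here b is the letter read before
  -- the word and i the number of letters read before it.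
  paths : End → Bool → ℕ → ℕ → ℕ → ℕ → Carrier
  paths e b h       zero    zero    i = e b i
  paths e b h       (suc k) zero    i = turn b i * paths e false (suc h) k zero (suc i)
  paths e b zero    zero    (suc l) i = 0#
  paths e b (suc h) zero    (suc l) i = paths e true h zero l (suc i)
  paths e b zero    (suc k) (suc l) i = turn b i * paths e false 1 k (suc l) (suc i)
  paths e b (suc h) (suc k) (suc l) i =
    turn b i * paths e false (suc (suc h)) k (suc l) (suc i) + paths e true h (suc k) l (suc i)

  one : End
  one _ _ = 1#

  paths-cong : ∀ {e e′ : End} → (∀ b i → e b i ≈ e′ b i) →
               ∀ b h k l i → paths e b h k l i ≈ paths e′ b h k l i
  paths-cong p b h       zero    zero    i = p b i
  paths-cong p b h       (suc k) zero    i = *-congˡ (paths-cong p false (suc h) k zero (suc i))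
  paths-cong p b zero    zero    (suc l) i = refl
  paths-cong p b (suc h) zero    (suc l) i = paths-cong p true h zero l (suc i)
  paths-cong p b zero    (suc k) (suc l) i = *-congˡ (paths-cong p false 1 k (suc l) (suc i))
  paths-cong p b (suc h) (suc k) (suc l) i =
    +-cong (*-congˡ (paths-cong p false (suc (suc h)) k (suc l) (suc i)))
           (paths-cong p true h (suc k) l (suc i))

  -- Decomposition at the first return

  -- Paths with n north steps from height h to height 0.
  dyck : Bool → ℕ → ℕ → ℕ → Carrier
  dyck b h n i = paths one b h n (h ℕ.+ n) i

  dyck-step : ∀ b h n i → dyck b (suc h) (suc n) i ≈
              turn b i * dyck false (suc (suc h)) n (suc i) + dyck true h (suc n) (suc i)
  dyck-step b h n i = +-congʳ (*-congˡ (reflexive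
    (≡.cong (λ l → paths one false (suc (suc h)) n l (suc i)) (≡.cong suc (ℕ.+-suc h n)))))

  dyck-≡ : ∀ b h n {i i′} → i ≡ i′ → dyck b h n i ≈ dyck b h n i′
  dyck-≡ b h n e = reflexive (≡.cong (dyck b h n) e)

  -- The path is cut at its first step to height h, which is preceded by a Dyck
  -- path with m north steps, thus by 2m letters.  The proof is by strong
  -- induction on n, with N as the induction variable.
  dyck-split-≤ : ∀ N b h n i → n ≤ N → dyck b (suc h) n i ≈
    conv n (λ m m′ → dyck b 0 m i * dyck true h m′ (suc (i ℕ.+ (m ℕ.+ m))))
  dyck-split-≤ N b h zero    i _ = begin
    dyck true h 0 (suc i)                      ≈⟨ dyck-≡ true h 0 (≡.cong suc (ℕ.+-identityʳ i)) ⟨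
    dyck true h 0 (suc (i ℕ.+ 0))              ≈⟨ *-identityˡ _ ⟨
    1# * dyck true h 0 (suc (i ℕ.+ 0))         ∎
  dyck-split-≤ (suc N) b h (suc n) i (s≤s n≤N) = begin
    dyck b (suc h) (suc n) i
      ≈⟨ dyck-step b h n i ⟩
    x * dyck false (suc (suc h)) n (suc i) + dyck true h (suc n) (suc i)
      ≈⟨ +-comm _ _ ⟩
    dyck true h (suc n) (suc i) + x * dyck false (suc (suc h)) n (suc i)
      ≈⟨ +-cong (trans (dyck-≡ true h (suc n) (≡.cong suc (≡.sym (ℕ.+-identityʳ i)))) (sym (*-identityˡ _)))
                (*-congˡ later) ⟩
    1# * dyck true h (suc n) (suc (i ℕ.+ 0)) + x * conv n (λ r u → dyck false 1 r (suc i) * D r u)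
      ≈⟨ +-congˡ (conv-* n x _) ⟨
    1# * dyck true h (suc n) (suc (i ℕ.+ 0)) + conv n (λ r u → x * (dyck false 1 r (suc i) * D r u))
      ≈⟨ +-congˡ (conv-cong n λ r u _ → *-assoc _ _ _) ⟨
    1# * dyck true h (suc n) (suc (i ℕ.+ 0)) + conv n (λ r u → dyck b 0 (suc r) i * D r u) ∎
    where
    x : Carrier
    x = turn b i

    D : ℕ → ℕ → Carrier
    D r u = dyck true h u (suc (i ℕ.+ (suc r ℕ.+ suc r)))

    index : ∀ i s t → suc (suc (suc i ℕ.+ (s ℕ.+ s)) ℕ.+ (t ℕ.+ t))
                      ≡ suc (i ℕ.+ (suc (s ℕ.+ t) ℕ.+ suc (s ℕ.+ t)))
    index = NS.solve-∀

    -- After a first north step the path starts at height h + 2.  It is cut at its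
    -- first steps to heights h + 1 and h, and the two pieces before the second
    -- cut are glued.
    later : dyck false (suc (suc h)) n (suc i) ≈ conv n (λ r u → dyck false 1 r (suc i) * D r u)
    later = begin
      dyck false (suc (suc h)) n (suc i)
        ≈⟨ dyck-split-≤ N false (suc h) n (suc i) n≤N ⟩
      conv n (λ s t → A s * dyck true (suc h) t (y s))
        ≈⟨ conv-cong n (λ s t s+t≡n → trans (*-congˡ (dyck-split-≤ N true h t (y s) (≤N s+t≡n))) (sym (conv-* t (A s) _))) ⟩
      conv n (λ s t → conv t (λ t′ u → A s * (dyck true 0 t′ (y s) * dyck true h u (suc (y s ℕ.+ (t′ ℕ.+ t′))))))
        ≈⟨ conv-assoc n _ ⟩
      conv n (λ r u → conv r (λ s t → A s * (dyck true 0 t (y s) * dyck true h u (suc (y s ℕ.+ (t ℕ.+ t))))))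
        ≈⟨ conv-cong n (λ r u r+u≡n → regroup r u (ℕ.≤-trans (ℕ.m+n≤o⇒m≤o r (ℕ.≤-reflexive r+u≡n)) n≤N)) ⟩
      conv n (λ r u → dyck false 1 r (suc i) * D r u) ∎
      where
      A : ℕ → Carrier
      A s = dyck false 0 s (suc i)
      y : ℕ → ℕ
      y s = suc (suc i ℕ.+ (s ℕ.+ s))
      ≤N : ∀ {s t} → s ℕ.+ t ≡ n → t ≤ N
      ≤N {s} s+t≡n = ℕ.≤-trans (ℕ.m+n≤o⇒n≤o s (ℕ.≤-reflexive s+t≡n)) n≤N
      regroup : ∀ r u → r ≤ N →
        conv r (λ s t → A s * (dyck true 0 t (y s) * dyck true h u (suc (y s ℕ.+ (t ℕ.+ t)))))
        ≈ dyck false 1 r (suc i) * D r u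
      regroup r u r≤N = begin
        conv r (λ s t → A s * (dyck true 0 t (y s) * dyck true h u (suc (y s ℕ.+ (t ℕ.+ t)))))
          ≈⟨ conv-cong r (λ { s t ≡.refl → trans
               (*-congˡ (*-congˡ (dyck-≡ true h u (index i s t))))
               (solve 3 (λ a b c → a :* (b :* c) := c :* (a :* b)) refl (A s) (dyck true 0 t (y s)) (D (s ℕ.+ t) u)) }) ⟩
        conv r (λ s t → D r u * (A s * dyck true 0 t (y s)))  ≈⟨ conv-* r (D r u) _ ⟩
        D r u * conv r (λ s t → A s * dyck true 0 t (y s))    ≈⟨ *-congˡ (dyck-split-≤ N false 0 r (suc i) r≤N) ⟨
        D r u * dyck false 1 r (suc i)                        ≈⟨ *-comm _ _ ⟩
        dyck false 1 r (suc i) * D r u                        ∎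

  -- A nonempty Dyck word is 0 D 1 D′.  When D′ is not empty it is preceded by an
  -- east step, whence the argument true.
  first-return : ∀ n i → dyck false 0 (suc n) i ≈
    conv n (λ m m′ → dyck false 0 m (suc i) * dyck true 0 m′ (suc (suc i ℕ.+ (m ℕ.+ m))))
  first-return n i = trans (*-identityˡ _) (dyck-split-≤ n false 0 n (suc i) ℕ.≤-refl)

  -- Removal of the last step

  -- End weights that account for one further step, so that a path followed by that
  -- step is a path with the new end weight.
  thenNorth thenEast : End → End
  thenNorth e b i = turn b i * e false (suc i)
  thenEast  e b i = e true (suc i)

  last-north : ∀ e b h k i → paths e b h (suc k) 0 i ≈ paths (thenNorth e) b h k 0 i
  last-north e b h zero    i = refl
  last-north e b h (suc k) i = *-congˡ (last-north e false (suc h) k (suc i))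

  last-east : ∀ e b h l i → suc l ≤ h → paths e b h 0 (suc l) i ≈ paths (thenEast e) b h 0 l i
  last-east e b (suc h) zero    i _       = refl
  last-east e b (suc h) (suc l) i (s≤s q) = last-east e true h l (suc i) q

  -- The bound says that the end height is not negative, so that a last east step
  -- is allowed after every path counted in the first summand.
  last-step : ∀ e b h k l i → suc l ≤ h ℕ.+ suc k →
    paths e b h (suc k) (suc l) i ≈
    paths (thenEast e) b h (suc k) l i + paths (thenNorth e) b h k (suc l) i
  last-step e b zero zero zero i q = sym (+-identityʳ _)
  last-step e b zero zero (suc l) i (s≤s ())
  last-step e b zero (suc k) zero i q =
    trans (*-congˡ (last-step e false 1 k 0 (suc i) (s≤s z≤n))) (distribˡ _ _ _)
  last-step e b zero (suc k) (suc l) i q =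
    trans (*-congˡ (last-step e false 1 k (suc l) (suc i) q)) (distribˡ _ _ _)
  last-step e b (suc h) zero zero i q =
    +-congˡ (last-north e true h 0 (suc i))
  last-step e b (suc h) zero (suc l) i (s≤s q) = begin
    turn b i * paths e false (2 ℕ.+ h) 0 (2 ℕ.+ l) (suc i) + paths e true h 1 (suc l) (suc i)
      ≈⟨ +-cong (*-congˡ (last-east e false (2 ℕ.+ h) (suc l) (suc i)
                   (s≤s (ℕ.≤-trans q (ℕ.≤-reflexive (ℕ.+-comm h 1))))))
                (last-step e true h 0 l (suc i) q) ⟩
    _ ≈⟨ +-assoc _ _ _ ⟨
    _ ∎
  last-step e b (suc h) (suc k) zero i q = begin
    turn b i * paths e false (2 ℕ.+ h) (suc k) 1 (suc i) + paths e true h (2 ℕ.+ k) 0 (suc i)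
      ≈⟨ +-cong (trans (*-congˡ (last-step e false (2 ℕ.+ h) k 0 (suc i) (s≤s z≤n))) (distribˡ _ _ _))
                (last-north e true h (suc k) (suc i)) ⟩
    _ ≈⟨ +-assoc _ _ _ ⟩
    _ ∎
  last-step e b (suc h) (suc k) (suc l) i (s≤s q) = begin
    turn b i * paths e false (2 ℕ.+ h) (suc k) (2 ℕ.+ l) (suc i) + paths e true h (2 ℕ.+ k) (suc l) (suc i)
      ≈⟨ +-cong (trans (*-congˡ (last-step e false (2 ℕ.+ h) k (suc l) (suc i)
                                  (s≤s (ℕ.≤-trans q (ℕ.≤-reflexive (ℕ.+-suc h (suc k)))))))
                       (distribˡ _ _ _))
                (last-step e true h (suc k) l (suc i) q) ⟩
    _ ≈⟨ interchange _ _ _ _ ⟩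
    _ ∎

  paths-below : ∀ e b h k l i → suc (h ℕ.+ k) ≤ l → paths e b h k l i ≈ 0#
  paths-below e b zero    zero    (suc l) i q = refl
  paths-below e b (suc h) zero    (suc l) i (s≤s q) = paths-below e true h 0 l (suc i) q
  paths-below e b zero    (suc k) (suc l) i q =
    trans (*-congˡ (paths-below e false 1 k (suc l) (suc i) q)) (zeroʳ _)
  paths-below e b (suc h) (suc k) (suc l) i (s≤s q) =
    trans (+-cong (trans (*-congˡ (paths-below e false (2 ℕ.+ h) k (suc l) (suc i)
                                    (s≤s (ℕ.≤-trans (ℕ.≤-reflexive (≡.sym (ℕ.+-suc (suc h) k))) q)) ))
                         (zeroʳ _))
                  (paths-below e true h (suc k) l (suc i) q))
          (+-identityˡ _)

  -- The major index generating function of ballot paths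

  -- All the paths counted have total length k + l, which fixes the end weight.
  paths-const : ∀ b h k l i → paths (λ _ j → z^ suc j) b h k l i
                ≈ z^ (suc (k ℕ.+ l ℕ.+ i)) * paths one b h k l i
  paths-const b h zero zero i = sym (*-identityʳ _)
  paths-const b h (suc k) zero i = trans (*-congˡ (paths-const false (suc h) k 0 (suc i)))
    (trans (solve 3 (λ x y w → x :* (y :* w) := y :* (x :* w)) refl _ _ _)
      (*-congʳ (z^≡ (≡.cong suc (ℕ.+-suc (k ℕ.+ 0) i)))))
  paths-const b zero zero (suc l) i = sym (zeroʳ _)
  paths-const b (suc h) zero (suc l) i = trans (paths-const true h 0 l (suc i))
    (*-congʳ (z^≡ (≡.cong suc (ℕ.+-suc l i))))
  paths-const b zero (suc k) (suc l) i = trans (*-congˡ (paths-const false 1 k (suc l) (suc i)))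
    (trans (solve 3 (λ x y w → x :* (y :* w) := y :* (x :* w)) refl _ _ _)
      (*-congʳ (z^≡ (≡.cong suc (ℕ.+-suc (k ℕ.+ suc l) i)))))
  paths-const b (suc h) (suc k) (suc l) i = begin
    _ ≈⟨ +-cong (*-congˡ (paths-const false (2 ℕ.+ h) k (suc l) (suc i))) (paths-const true h (suc k) l (suc i)) ⟩
    _ ≈⟨ +-cong (*-congˡ (*-congʳ (z^≡ (≡.cong suc (ℕ.+-suc (k ℕ.+ suc l) i)))))
                (*-congʳ (z^≡ (≡.cong suc (index k l i)))) ⟩
    _ ≈⟨ solve 4 (λ x y v w → x :* (y :* v) :+ y :* w := y :* (x :* v :+ w)) refl _ _ _ _ ⟩
    _ ∎
    where
    index : ∀ k l i → suc k ℕ.+ l ℕ.+ suc i ≡ suc k ℕ.+ suc l ℕ.+ i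
    index = NS.solve-∀

  northEnd : End
  northEnd = thenNorth one

  -- Ballot paths with a north and b east steps by the major index; for ballotN
  -- the words are extended by one more north step.
  ballot ballotN : ℕ → ℕ → Carrier
  ballot  a b = paths one      false 0 a b 0
  ballotN a b = paths northEnd false 0 a b 0

  -- gap x a b = [a + b choose b] - x [a + b choose b - 1].
  gap : Carrier → ℕ → ℕ → Carrier
  gap x a zero    = 1#
  gap x a (suc b) = g a (suc b) + x * - g (suc a) b

  neg-pascal₂ : ∀ a b → - g (suc a) (suc b) ≈ z^ (suc b) * - g a (suc b) + - g (suc a) b
  neg-pascal₂ a b = begin
    - g (suc a) (suc b)                           ≈⟨ -‿cong (pascal₂ a b) ⟩
    - (z^ (suc b) * g a (suc b) + g (suc a) b)    ≈⟨ -‿+-comm _ _ ⟨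
    - (z^ (suc b) * g a (suc b)) + - g (suc a) b  ≈⟨ +-congʳ (-‿distribʳ-* _ _) ⟩
    z^ (suc b) * - g a (suc b) + - g (suc a) b    ∎

  neg-pascal₁ : ∀ a b → - g (suc a) (suc b) ≈ - g a (suc b) + z^ (suc a) * - g (suc a) b
  neg-pascal₁ a b = trans (sym (-‿+-comm _ _)) (+-congˡ (-‿distribʳ-* _ _))

  -- The recursion of last-step, for the closed form of ballot.
  ballot-north : ∀ a b →
    gap z (suc a) b + z^ (suc b) * gap 1# a (suc b) ≈ gap z (suc a) (suc b)
  ballot-north a zero = begin
    1# + z * 1# * (g a 1 + 1# * - g (suc a) 0)
      ≈⟨ solve 3 (λ z u v → con 1 :+ z :* con 1 :* (u :+ con 1 :* v) := (z :* con 1 :* u :+ con 1) :+ z :* v)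
           refl z (g a 1) (- 1#) ⟩
    (z^ 1 * g a 1 + 1#) + z * - 1#      ≈⟨ +-congʳ (pascal₂ a 0) ⟨
    g (suc a) 1 + z * - g (2 ℕ.+ a) 0   ∎
  ballot-north a (suc b) = begin
    (G₁ + z * M₁) + z^ (2 ℕ.+ b) * (G₂ + 1# * M₂)
      ≈⟨ solve 6 (λ z x g₁ m₁ g₂ m₂ → (g₁ :+ z :* m₁) :+ z :* x :* (g₂ :+ con 1 :* m₂)
            := (z :* x :* g₂ :+ g₁) :+ z :* (x :* m₂ :+ m₁)) refl z (z^ (suc b)) G₁ M₁ G₂ M₂ ⟩
    (z^ (2 ℕ.+ b) * G₂ + G₁) + z * (z^ (suc b) * M₂ + M₁)
      ≈⟨ +-cong (pascal₂ a (suc b)) (*-congˡ (neg-pascal₂ (suc a) b)) ⟨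
    g (suc a) (2 ℕ.+ b) + z * - g (2 ℕ.+ a) (suc b) ∎
    where
    G₁ M₁ G₂ M₂ : Carrier
    G₁ = g (suc a) (suc b)
    M₁ = - g (2 ℕ.+ a) b
    G₂ = g a (2 ℕ.+ b)
    M₂ = - g (suc a) (suc b)

  -- The same for ballotN: here a last east step is followed by the additional north
  -- step, and forms a descent at position a + b + 2.
  ballotN-north : ∀ a b →
    z^ (suc (suc (a ℕ.+ b))) * gap z (suc a) b + z^ (suc b) * gap 1# a (suc b)
    ≈ z^ (suc b) * gap 1# (suc a) (suc b)
  ballotN-north a b = begin
    z^ (2 ℕ.+ (a ℕ.+ b)) * gap z (suc a) b + X * gap 1# a (suc b)
      ≈⟨ +-congʳ (*-congʳ (trans (z^≡ (index a b)) (z^+ (suc b) (suc a)))) ⟩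
    X * Y * gap z (suc a) b + X * gap 1# a (suc b)
      ≈⟨ solve 4 (λ x y p q → x :* y :* p :+ x :* q := x :* (y :* p :+ q)) refl X Y _ _ ⟩
    X * (Y * gap z (suc a) b + gap 1# a (suc b)) ≈⟨ *-congˡ (inner b) ⟩
    X * gap 1# (suc a) (suc b) ∎
    where
    X Y : Carrier
    X = z^ (suc b)
    Y = z^ (suc a)
    index : ∀ a b → suc (suc (a ℕ.+ b)) ≡ suc b ℕ.+ suc a
    index = NS.solve-∀
    inner : ∀ b → Y * gap z (suc a) b + gap 1# a (suc b) ≈ gap 1# (suc a) (suc b)
    inner zero    = solve 3 (λ y u v → y :* con 1 :+ (u :+ con 1 :* v) := (u :+ y :* con 1) :+ con 1 :* v)
                      refl Y (g a 1) (- 1#)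
    inner (suc b) = begin
      Y * (g (suc a) (suc b) + z * - g (2 ℕ.+ a) b) + (g a (2 ℕ.+ b) + 1# * - g (suc a) (suc b))
        ≈⟨ solve 6 (λ y z p m q k → y :* (p :+ z :* m) :+ (q :+ con 1 :* k)
              := (q :+ y :* p) :+ con 1 :* (k :+ z :* y :* m)) refl Y z _ _ _ _ ⟩
      g (suc a) (2 ℕ.+ b) + 1# * (- g (suc a) (suc b) + z^ (2 ℕ.+ a) * - g (2 ℕ.+ a) b)
        ≈⟨ +-congˡ (*-congˡ (neg-pascal₁ (suc a) b)) ⟨
      g (suc a) (2 ℕ.+ b) + 1# * - g (2 ℕ.+ a) (suc b) ∎

  -- The two formulas are proved together from last-step.  For b = a + 1 there is
  -- no path, and the symmetry of g makes the right-hand side of the second formula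
  -- vanish too.
  ballot-closed  : ∀ a b → b ≤ a → ballot a b ≈ gap z a b
  ballotN-closed : ∀ a b → b ≤ suc a → ballotN a b ≈ z^ b * gap 1# a b

  ballot-closed zero    zero    q = refl
  ballot-closed (suc a) zero    q = begin
    ballot (suc a) 0    ≈⟨ last-north one false 0 a 0 ⟩
    ballotN a 0         ≈⟨ ballotN-closed a 0 z≤n ⟩
    1# * 1#             ≈⟨ *-identityˡ _ ⟩
    1#                  ∎
  ballot-closed (suc a) (suc b) (s≤s q) = begin
    ballot (suc a) (suc b)                       ≈⟨ last-step one false 0 a b 0 (s≤s q) ⟩
    ballot (suc a) b + ballotN a (suc b)
      ≈⟨ +-cong (ballot-closed (suc a) b (ℕ.m≤n⇒m≤1+n q)) (ballotN-closed a (suc b) (s≤s q)) ⟩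
    gap z (suc a) b + z^ (suc b) * gap 1# a (suc b) ≈⟨ ballot-north a b ⟩
    gap z (suc a) (suc b)                        ∎

  ballotN-closed zero    zero    q = refl
  ballotN-closed (suc a) zero    q = begin
    ballotN (suc a) 0 ≈⟨ last-north northEnd false 0 a 0 ⟩
    paths (thenNorth northEnd) false 0 a 0 0
      ≈⟨ paths-cong (λ b i → *-congˡ (*-identityˡ _)) false 0 a 0 0 ⟩
    ballotN a 0       ≈⟨ ballotN-closed a 0 z≤n ⟩
    1# * 1#           ∎
  ballotN-closed zero    (suc zero) q = begin
    0#                       ≈⟨ zeroʳ _ ⟨
    z^ 1 * 0#                ≈⟨ *-congˡ (trans (+-congˡ (*-identityˡ _)) (-‿inverseʳ 1#)) ⟨
    z^ 1 * (1# + 1# * - 1#)  ∎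
  ballotN-closed zero    (suc (suc b)) (s≤s ())
  ballotN-closed (suc a) (suc b) (s≤s q) with ℕ.m≤n⇒m<n∨m≡n q
  ... | inj₁ b<1+a = begin
    ballotN (suc a) (suc b)     ≈⟨ last-step northEnd false 0 a b 0 b<1+a ⟩
    paths (thenEast northEnd) false 0 (suc a) b 0 + paths (thenNorth northEnd) false 0 a (suc b) 0
      ≈⟨ +-cong (trans (paths-cong (λ b i → *-identityʳ _) false 0 (suc a) b 0)
                       (paths-const false 0 (suc a) b 0))
                (paths-cong (λ b i → *-congˡ (*-identityˡ _)) false 0 a (suc b) 0) ⟩
    z^ (suc (suc a ℕ.+ b ℕ.+ 0)) * ballot (suc a) b + ballotN a (suc b)
      ≈⟨ +-cong (*-cong (z^≡ (ℕ.+-identityʳ (2 ℕ.+ (a ℕ.+ b)))) (ballot-closed (suc a) b q))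
                (ballotN-closed a (suc b) b<1+a) ⟩
    z^ (suc (suc (a ℕ.+ b))) * gap z (suc a) b + z^ (suc b) * gap 1# a (suc b)
      ≈⟨ ballotN-north a b ⟩
    z^ (suc b) * gap 1# (suc a) (suc b) ∎
  ... | inj₂ ≡.refl = begin
    ballotN (suc a) (2 ℕ.+ a)   ≈⟨ paths-below northEnd false 0 (suc a) (2 ℕ.+ a) 0 ℕ.≤-refl ⟩
    0#                          ≈⟨ zeroʳ _ ⟨
    z^ (2 ℕ.+ a) * 0#           ≈⟨ *-congˡ (-‿inverseʳ (g (2 ℕ.+ a) (suc a))) ⟨
    z^ (2 ℕ.+ a) * (g (2 ℕ.+ a) (suc a) + - g (2 ℕ.+ a) (suc a))
      ≈⟨ *-congˡ (+-cong (g-sym (2 ℕ.+ a) (suc a)) (sym (*-identityˡ _))) ⟩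
    z^ (2 ℕ.+ a) * gap 1# (suc a) (2 ℕ.+ a) ∎

  dyck-closed : ∀ n → dyck false 0 n 0 ≈ H n 1
  dyck-closed zero    = refl
  dyck-closed (suc n) = begin
    ballot (suc n) (suc n)                        ≈⟨ ballot-closed (suc n) (suc n) ℕ.≤-refl ⟩
    g (suc n) (suc n) + z * - g (2 ℕ.+ n) n       ≈⟨ +-cong (g-≡ (suc n) (ℕ.+-comm 1 n))
       (*-cong (sym (*-identityʳ z)) (-‿cong (g-≡ n (≡.cong suc (ℕ.+-comm 1 n))))) ⟩
    g (n ℕ.+ 1) (suc n) + z^ 1 * - g (suc (n ℕ.+ 1)) n ∎

-- Lehmer codes of permutations
module Codes where
  open import Data.Nat.Base
  open import Data.Nat.Properties
  open ≡ hiding ([_])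
  open ≡-Reasoning

  -- Code n c says that c is the Lehmer code of a permutation of size n: an entry
  -- counts the later values that are smaller, so it is at most the number of
  -- later entries.
  data Code : ℕ → List ℕ → Set where
    []  : Code 0 []
    _∷_ : ∀ {n i c} → i ≤ n → Code n c → Code (suc n) (i ∷ c)

  -- punch i is the increasing map of ℕ onto the numbers other than i.
  punch : ℕ → ℕ → ℕ
  punch zero    v       = suc v
  punch (suc i) zero    = zero
  punch (suc i) (suc v) = suc (punch i v)

  -- The one-line notation of the permutation with the given code, with the
  -- values 0, …, n-1.
  values : List ℕ → List ℕ
  values []      = []
  values (i ∷ c) = i ∷ map (punch i) (values c)

  -- Insertion of the value 0 at position i, which is meant to be at most the
  -- length of the list; larger positions do not occur.
  insertZero : ℕ → List ℕ → List ℕ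
  insertZero zero    xs       = 0 ∷ xs
  insertZero (suc i) []       = 0 ∷ []
  insertZero (suc i) (x ∷ xs) = x ∷ insertZero i xs

  -- The one-line notation of the inverse permutation.
  inverse : List ℕ → List ℕ
  inverse []      = []
  inverse (i ∷ c) = insertZero i (map suc (inverse c))

  -- splits p c says that the first p entries of c form a code of size p, that is,
  -- that the permutation is a direct sum whose first summand has size p.
  splits : ℕ → List ℕ → Bool
  splits zero    c       = true
  splits (suc p) []      = false
  splits (suc p) (i ∷ c) = (i <ᵇ suc p) ∧ splits p c

  -- Avoidance of 231 on codes: after each value, the smaller ones among the later
  -- values come before the larger ones.
  avoids : List ℕ → Bool
  avoids []      = true
  avoids (i ∷ c) = splits i c ∧ avoids c

  punch-< : ∀ {i v} → v < i → punch i v ≡ v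
  punch-< {suc i} {zero}  _       = refl
  punch-< {suc i} {suc v} (s≤s p) = cong suc (punch-< p)

  punch-≥ : ∀ {i v} → i ≤ v → punch i v ≡ suc v
  punch-≥ {zero}          _       = refl
  punch-≥ {suc i} {suc v} (s≤s p) = cong suc (punch-≥ p)

  punch-mono : ∀ i {v w} → v < w → punch i v < punch i w
  punch-mono zero                    p       = s≤s p
  punch-mono (suc i) {zero}  {suc w} p       = s≤s z≤n
  punch-mono (suc i) {suc v} {suc w} (s≤s p) = s≤s (punch-mono i p)

  punch-cancel : ∀ i {v w} → punch i v < punch i w → v < w
  punch-cancel zero                    (s≤s p) = p
  punch-cancel (suc i) {zero}  {suc w} p       = s≤s z≤n
  punch-cancel (suc i) {suc v} {suc w} (s≤s p) = s≤s (punch-cancel i p)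

  toℕ-punchIn : ∀ {n} (i : Fin (suc n)) (j : Fin n) → toℕ (punchIn i j) ≡ punch (toℕ i) (toℕ j)
  toℕ-punchIn Fin.zero    j           = refl
  toℕ-punchIn (Fin.suc i) Fin.zero    = refl
  toℕ-punchIn (Fin.suc i) (Fin.suc j) = cong suc (toℕ-punchIn i j)

  punch-below : ∀ {i p v} → i ≤ p → v < p → punch i v < suc p
  punch-below {i} {p} {v} i≤p v<p = subst (punch i v <_) (punch-≥ i≤p) (punch-mono i v<p)

  punch-below⁻ : ∀ {i p v} → i ≤ p → punch i v < suc p → v < p
  punch-below⁻ {i} {p} {v} i≤p q = punch-cancel i (subst (punch i v <_) (sym (punch-≥ i≤p)) q)

  punch-low⁻ : ∀ {i v} → punch i v < i → v < i
  punch-low⁻ {i} {v} q with v <? i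
  ... | yes v<i = v<i
  ... | no  v≮i = contradiction (subst (_< i) (punch-≥ (≮⇒≥ v≮i)) q) (λ r → v≮i (≤-trans (n≤1+n (suc v)) r))

  punch-high⁻ : ∀ {i v} → i < punch i v → i ≤ v
  punch-high⁻ {i} {v} q with v <? i
  ... | yes v<i = contradiction (subst (i <_) (punch-< v<i) q) (<-asym v<i)
  ... | no  v≮i = ≮⇒≥ v≮i

  length-insertZero : ∀ i xs → i ≤ length xs → length (insertZero i xs) ≡ suc (length xs)
  length-insertZero zero    xs       _       = refl
  length-insertZero (suc i) (x ∷ xs) (s≤s p) = cong suc (length-insertZero i xs p)

  length-values : ∀ {n c} → Code n c → length (values c) ≡ n
  length-values []            = refl
  length-values (_∷_ {i = i} {c = c} _ cc) = cong suc (trans (length-map (punch i) (values c)) (length-values cc))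

  length-inverse : ∀ {n c} → Code n c → length (inverse c) ≡ n
  length-inverse []       = refl
  length-inverse (_∷_ {n} {i} {c} i≤n cc) = begin
    length (insertZero i (map suc (inverse c))) ≡⟨ length-insertZero i _ (≤-trans i≤n (≤-reflexive (sym len))) ⟩
    suc (length (map suc (inverse c)))          ≡⟨ cong suc len ⟩
    suc n                                       ∎
    where
    len : length (map suc (inverse c)) ≡ n
    len = trans (length-map suc (inverse c)) (length-inverse cc)

  values-< : ∀ {n c} → Code n c → All (_< n) (values c)
  values-< []         = []
  values-< (i≤n ∷ cc) = s≤s i≤n ∷ All.map⁺ (All.map (punch-below i≤n) (values-< cc))

  insertZero-All : ∀ {P : ℕ → Set} i {xs} → P 0 → All P xs → All P (insertZero i xs)
  insertZero-All zero    p ps       = p ∷ ps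
  insertZero-All (suc i) p []       = p ∷ []
  insertZero-All (suc i) p (q ∷ ps) = q ∷ insertZero-All i p ps

  inverse-< : ∀ {n c} → Code n c → All (_< n) (inverse c)
  inverse-< []                   = []
  inverse-< (_∷_ {i = i} i≤n cc) = insertZero-All i (s≤s z≤n) (All.map⁺ (All.map s≤s (inverse-< cc)))

  -- Concatenation of codes is the direct sum of permutations

  splits-++ : ∀ {n c} → Code n c → ∀ d i → i ≤ n → splits i (c ++ d) ≡ splits i c
  splits-++ _        d zero    _       = refl
  splits-++ (_∷_ {i = j} _ cc) d (suc i) (s≤s q) = cong ((j <ᵇ suc i) ∧_) (splits-++ cc d i q)

  avoids-++ : ∀ {n c} → Code n c → ∀ d → avoids (c ++ d) ≡ avoids c ∧ avoids d
  avoids-++ []         d = refl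
  avoids-++ (_∷_ {i = i} {c = c} i≤n cc) d = begin
    splits i (c ++ d) ∧ avoids (c ++ d)  ≡⟨ cong₂ _∧_ (splits-++ cc d i i≤n) (avoids-++ cc d) ⟩
    splits i c ∧ (avoids c ∧ avoids d)   ≡⟨ ∧-assoc (splits i c) _ _ ⟨
    (splits i c ∧ avoids c) ∧ avoids d   ∎

  map-punch-≥ : ∀ {i n} → i ≤ n → ∀ xs → map (punch i) (map (n +_) xs) ≡ map (suc n +_) xs
  map-punch-≥ {i} {n} i≤n xs =
    trans (sym (map-∘ xs)) (map-cong (λ v → punch-≥ (≤-trans i≤n (m≤m+n n v))) xs)

  values-++ : ∀ {n c} → Code n c → ∀ d → values (c ++ d) ≡ values c ++ map (n +_) (values d)
  values-++ []         d = sym (map-id (values d))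
  values-++ (_∷_ {n} {i} {c} i≤n cc) d = cong (i ∷_) (begin
    map (punch i) (values (c ++ d))                                   ≡⟨ cong (map (punch i)) (values-++ cc d) ⟩
    map (punch i) (values c ++ map (n +_) (values d))                 ≡⟨ map-++ (punch i) (values c) _ ⟩
    map (punch i) (values c) ++ map (punch i) (map (n +_) (values d)) ≡⟨ cong (_ ++_) (map-punch-≥ i≤n (values d)) ⟩
    map (punch i) (values c) ++ map (suc n +_) (values d)             ∎)

  insertZero-++ : ∀ i xs ys → i ≤ length xs → insertZero i (xs ++ ys) ≡ insertZero i xs ++ ys
  insertZero-++ zero    xs       ys _       = refl
  insertZero-++ (suc i) (x ∷ xs) ys (s≤s p) = cong (x ∷_) (insertZero-++ i xs ys p)

  inverse-++ : ∀ {n c} → Code n c → ∀ d → inverse (c ++ d) ≡ inverse c ++ map (n +_) (inverse d)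
  inverse-++ []         d = sym (map-id (inverse d))
  inverse-++ (_∷_ {n} {i} {c} i≤n cc) d = begin
    insertZero i (map suc (inverse (c ++ d)))
      ≡⟨ cong (insertZero i ∘ map suc) (inverse-++ cc d) ⟩
    insertZero i (map suc (inverse c ++ map (n +_) (inverse d)))
      ≡⟨ cong (insertZero i) (trans (map-++ suc (inverse c) _) (cong (_ ++_) (sym (map-∘ (inverse d))))) ⟩
    insertZero i (map suc (inverse c) ++ map (suc n +_) (inverse d))
      ≡⟨ insertZero-++ i (map suc (inverse c)) _ (≤-trans i≤n (≤-reflexive
           (sym (trans (length-map suc (inverse c)) (length-inverse cc))))) ⟩
    insertZero i (map suc (inverse c)) ++ map (suc n +_) (inverse d) ∎

  insertZero-end : ∀ xs → insertZero (length xs) xs ≡ xs ++ [ 0 ]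
  insertZero-end []       = refl
  insertZero-end (x ∷ xs) = cong (x ∷_) (insertZero-end xs)

  -- A 231-avoiding permutation with p values below its initial one: p, the block
  -- of the smaller values, the block of the larger values.
  values-block : ∀ {p c} → Code p c → ∀ d →
                 values (p ∷ c ++ d) ≡ (p ∷ values c) ++ map (suc p +_) (values d)
  values-block {p} {c} cc d = trans (values-++ (≤-refl ∷ cc) d) (cong (λ xs → p ∷ xs ++ map (suc p +_) (values d))
    (trans (map-cong-local (All.map punch-< (values-< cc))) (map-id (values c))))

  -- In the inverse the value 0 stands at position p, between the lower block
  -- shifted by one and the upper block.
  inverse-block : ∀ {p c} → Code p c → ∀ d →
                  inverse (p ∷ c ++ d) ≡ (map suc (inverse c) ++ [ 0 ]) ++ map (suc p +_) (inverse d)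
  inverse-block {p} {c} cc d = trans (inverse-++ (≤-refl ∷ cc) d) (cong (_++ map (suc p +_) (inverse d)) (begin
    insertZero p (map suc (inverse c))
      ≡⟨ cong (λ k → insertZero k (map suc (inverse c))) (sym (trans (length-map suc (inverse c)) (length-inverse cc))) ⟩
    insertZero (length (map suc (inverse c))) (map suc (inverse c))
      ≡⟨ insertZero-end (map suc (inverse c)) ⟩
    map suc (inverse c) ++ [ 0 ] ∎))

  -- Ascents and descents

  -- The sum of the ascent positions of a list; positions are counted from i + 1
  -- on.
  asc : ℕ → List ℕ → ℕ
  asc i []          = 0
  asc i (x ∷ [])    = 0
  asc i (x ∷ y ∷ l) = (if x <ᵇ y then suc i else 0) + asc (suc i) (y ∷ l)

  asc-map-suc : ∀ i xs → asc i (map suc xs) ≡ asc i xs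
  asc-map-suc i []          = refl
  asc-map-suc i (x ∷ [])    = refl
  asc-map-suc i (x ∷ y ∷ l) = cong ((if x <ᵇ y then suc i else 0) +_) (asc-map-suc (suc i) (y ∷ l))

  asc-map-+ : ∀ p i xs → asc i (map (p +_) xs) ≡ asc i xs
  asc-map-+ zero    i xs = cong (asc i) (map-id xs)
  asc-map-+ (suc p) i xs = trans (cong (asc i) (map-∘ xs)) (trans (asc-map-suc i (map (p +_) xs)) (asc-map-+ p i xs))

  <ᵇ-true : ∀ {x y} → x < y → (x <ᵇ y) ≡ true
  <ᵇ-true {zero}  {suc y} _       = refl
  <ᵇ-true {suc x} {suc y} (s≤s p) = <ᵇ-true p

  <ᵇ-false : ∀ {x y} → y ≤ x → (x <ᵇ y) ≡ false
  <ᵇ-false {x}     {zero}  _       = refl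
  <ᵇ-false {suc x} {suc y} (s≤s p) = <ᵇ-false p

  -- There is no ascent at the seam when everything before it exceeds what follows.
  asc-drop : ∀ {p} i {xs ys} → All (p ≤_) xs → All (_< p) ys →
             asc i (xs ++ ys) ≡ asc i xs + asc (i + length xs) ys
  asc-drop i {ys = ys} [] qs = cong (λ j → asc j ys) (sym (+-identityʳ i))
  asc-drop i {x ∷ []} (p ∷ []) [] = refl
  asc-drop i {x ∷ []} {y ∷ ys} (p ∷ []) (q ∷ qs) rewrite <ᵇ-false (≤-trans (<⇒≤ q) p) =
    cong (λ j → asc j (y ∷ ys)) (+-comm 1 i)
  asc-drop i {x ∷ x′ ∷ xs} {ys} (p ∷ ps) qs = begin
    u + asc (suc i) (x′ ∷ xs ++ ys)                                    ≡⟨ cong (u +_) (asc-drop (suc i) ps qs) ⟩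
    u + (asc (suc i) (x′ ∷ xs) + asc (suc i + length (x′ ∷ xs)) ys)    ≡⟨ +-assoc u _ _ ⟨
    (u + asc (suc i) (x′ ∷ xs)) + asc (suc i + length (x′ ∷ xs)) ys
      ≡⟨ cong (λ j → (u + asc (suc i) (x′ ∷ xs)) + asc j ys) (sym (+-suc i _)) ⟩
    (u + asc (suc i) (x′ ∷ xs)) + asc (i + length (x ∷ x′ ∷ xs)) ys    ∎
    where
    u : ℕ
    u = if x <ᵇ x′ then suc i else 0

  -- There is an ascent at the seam when everything before it is below what
  -- follows.
  asc-rise : ∀ {p} i {x xs y ys} → All (_< p) (x ∷ xs) → All (p ≤_) (y ∷ ys) →
             asc i ((x ∷ xs) ++ y ∷ ys) ≡
             asc i (x ∷ xs) + ((i + length (x ∷ xs)) + asc (i + length (x ∷ xs)) (y ∷ ys))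
  asc-rise i {x} {[]} {y} {ys} (p ∷ []) (q ∷ qs) rewrite <ᵇ-true (≤-trans p q) =
    cong (λ j → j + asc j (y ∷ ys)) (+-comm 1 i)
  asc-rise i {x} {x′ ∷ xs} {y} {ys} (p ∷ ps) qs = begin
    u + asc (suc i) (x′ ∷ xs ++ y ∷ ys)   ≡⟨ cong (u +_) (asc-rise (suc i) ps qs) ⟩
    u + (asc (suc i) (x′ ∷ xs) + F (suc i + length (x′ ∷ xs))) ≡⟨ +-assoc u _ _ ⟨
    (u + asc (suc i) (x′ ∷ xs)) + F (suc i + length (x′ ∷ xs))
      ≡⟨ cong (λ j → (u + asc (suc i) (x′ ∷ xs)) + F j) (sym (+-suc i _)) ⟩
    (u + asc (suc i) (x′ ∷ xs)) + F (i + length (x ∷ x′ ∷ xs)) ∎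
    where
    u : ℕ
    u = if x <ᵇ x′ then suc i else 0
    F : ℕ → ℕ
    F j = j + asc j (y ∷ ys)

  -- The part of the ascent sum due to an upper block ys that follows a lower block
  -- ending at position i.  The seam is an ascent, unless ys is empty.
  upper : ℕ → List ℕ → ℕ
  upper i []       = 0
  upper i (y ∷ ys) = i + asc i (y ∷ ys)

  asc-upper : ∀ {p} i {x xs} ys → All (_< p) (x ∷ xs) →
    asc i ((x ∷ xs) ++ map (p +_) ys) ≡ asc i (x ∷ xs) + upper (i + length (x ∷ xs)) ys
  asc-upper {p} i {x} {xs} []       ps = trans (cong (asc i) (++-identityʳ (x ∷ xs))) (sym (+-identityʳ _))
  asc-upper {p} i {x} {xs} (y ∷ ys) ps =
    trans (asc-rise i ps (m≤m+n p y ∷ All.map⁺ (All.universal (λ v → m≤m+n p v) ys)))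
      (cong (λ k → asc i (x ∷ xs) + ((i + length (x ∷ xs)) + k)) (asc-map-+ p (i + length (x ∷ xs)) (y ∷ ys)))

  asc-values-block : ∀ {p c} i d → Code p c → asc i (values (p ∷ c ++ d)) ≡
                     asc (suc i) (values c) + upper (i + suc p) (values d)
  asc-values-block {p} {c} i d cc = begin
    asc i (values (p ∷ c ++ d))                              ≡⟨ cong (asc i) (values-block cc d) ⟩
    asc i ((p ∷ values c) ++ map (suc p +_) (values d))
      ≡⟨ asc-upper i (values d) (≤-refl ∷ All.map m≤n⇒m≤1+n (values-< cc)) ⟩
    asc i (p ∷ values c) + upper (i + suc (length (values c))) (values d)
      ≡⟨ cong₂ _+_ (trans (asc-drop i (≤-refl ∷ []) (values-< cc)) (cong (λ j → asc j (values c)) (+-comm i 1)))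
                   (cong (λ k → upper (i + suc k) (values d)) (length-values cc)) ⟩
    asc (suc i) (values c) + upper (i + suc p) (values d)    ∎

  asc-inverse-block : ∀ {p c} i d → Code p c → asc i (inverse (p ∷ c ++ d)) ≡
                      asc i (inverse c) + upper (i + suc p) (inverse d)
  asc-inverse-block {p} {c} i d cc = begin
    asc i (inverse (p ∷ c ++ d))                             ≡⟨ cong (asc i) (inverse-block cc d) ⟩
    asc i (lower ++ map (suc p +_) (inverse d))              ≡⟨ lem lower lower-< lower-length ⟩
    asc i lower + upper (i + suc p) (inverse d)              ≡⟨ cong (_+ _) asc-lower ⟩
    asc i (inverse c) + upper (i + suc p) (inverse d)        ∎
    where
    lower : List ℕ
    lower = map suc (inverse c) ++ [ 0 ]
    lower-< : All (_< suc p) lower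
    lower-< = All.++⁺ (All.map⁺ (All.map s≤s (inverse-< cc))) (s≤s z≤n ∷ [])
    lower-length : length lower ≡ suc p
    lower-length = trans (length-++ (map suc (inverse c)))
      (trans (+-comm _ 1) (cong suc (trans (length-map suc (inverse c)) (length-inverse cc))))
    asc-lower : asc i lower ≡ asc i (inverse c)
    asc-lower = begin
      asc i lower                          ≡⟨ asc-drop i (All.map⁺ (All.universal (λ _ → s≤s z≤n) (inverse c))) (s≤s z≤n ∷ []) ⟩
      asc i (map suc (inverse c)) + 0      ≡⟨ +-identityʳ _ ⟩
      asc i (map suc (inverse c))          ≡⟨ asc-map-suc i (inverse c) ⟩
      asc i (inverse c)                    ∎
    lem : ∀ l → All (_< suc p) l → length l ≡ suc p →
          asc i (l ++ map (suc p +_) (inverse d)) ≡ asc i l + upper (i + suc p) (inverse d)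
    lem (x ∷ l) ps e = trans (asc-upper i (inverse d) ps) (cong (λ k → asc i (x ∷ l) + upper (i + k) (inverse d)) e)

  -- The code of a permutation

  -- Represents σ c says that c is the code of σ; it follows the recursion by which
  -- the permutations are enumerated, on the initial value.
  data Represents : ∀ {n} → Permutation′ n → List ℕ → Set where
    []  : Represents {0} Perm.id []
    _∷_ : ∀ {n π c} (i : Fin (suc n)) → Represents π c → Represents (insert 0F i π) (toℕ i ∷ c)

  values-correct : ∀ {n} {σ : Permutation′ n} {c} → Represents σ c → tabulate (toℕ ∘ (σ ⟨$⟩ʳ_)) ≡ values c
  values-correct []      = refl
  values-correct (_∷_ {π = π} {c = c} i r) = cong (toℕ i ∷_) (begin
    tabulate (toℕ ∘ punchIn i ∘ (π ⟨$⟩ʳ_))                  ≡⟨ tabulate-cong (λ k → toℕ-punchIn i (π ⟨$⟩ʳ k)) ⟩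
    tabulate (punch (toℕ i) ∘ toℕ ∘ (π ⟨$⟩ʳ_))              ≡⟨ map-tabulate (toℕ ∘ (π ⟨$⟩ʳ_)) (punch (toℕ i)) ⟨
    map (punch (toℕ i)) (tabulate (toℕ ∘ (π ⟨$⟩ʳ_)))        ≡⟨ cong (map (punch (toℕ i))) (values-correct r) ⟩
    map (punch (toℕ i)) (values c)                          ∎)

  -- A sequence that is 0 at i and agrees with g elsewhere is g with 0 inserted at
  -- position i.
  tabulate-insertZero : ∀ {n} (i : Fin (suc n)) (f : Fin (suc n) → ℕ) (g : Fin n → ℕ) → f i ≡ 0 →
    (∀ k → f (punchIn i k) ≡ g k) → tabulate f ≡ insertZero (toℕ i) (tabulate g)
  tabulate-insertZero Fin.zero f g p q = cong₂ _∷_ p (tabulate-cong q)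
  tabulate-insertZero {suc n} (Fin.suc i) f g p q =
    cong₂ _∷_ (q 0F) (tabulate-insertZero i (f ∘ Fin.suc) (g ∘ Fin.suc) p (q ∘ Fin.suc))

  inverse-correct : ∀ {n} {σ : Permutation′ n} {c} → Represents σ c →
                    tabulate (toℕ ∘ (flip σ ⟨$⟩ʳ_)) ≡ inverse c
  inverse-correct []      = refl
  inverse-correct (_∷_ {π = π} {c = c} i r) = begin
    tabulate (toℕ ∘ (σ ⟨$⟩ˡ_))
      ≡⟨ tabulate-insertZero i (toℕ ∘ (σ ⟨$⟩ˡ_)) (suc ∘ toℕ ∘ (π ⟨$⟩ˡ_)) (cong toℕ (Perm.inverseˡ σ)) at-punch ⟩
    insertZero (toℕ i) (tabulate (suc ∘ toℕ ∘ (π ⟨$⟩ˡ_)))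
      ≡⟨ cong (insertZero (toℕ i)) (map-tabulate (toℕ ∘ (π ⟨$⟩ˡ_)) suc) ⟨
    insertZero (toℕ i) (map suc (tabulate (toℕ ∘ (π ⟨$⟩ˡ_))))
      ≡⟨ cong (insertZero (toℕ i) ∘ map suc) (inverse-correct r) ⟩
    insertZero (toℕ i) (map suc (inverse c)) ∎
    where
    σ = insert 0F i π
    at-punch : ∀ k → toℕ (σ ⟨$⟩ˡ punchIn i k) ≡ suc (toℕ (π ⟨$⟩ˡ k))
    at-punch k = cong toℕ (begin
      σ ⟨$⟩ˡ punchIn i k                           ≡⟨ cong (λ l → σ ⟨$⟩ˡ punchIn i l) (Perm.inverseʳ π) ⟨
      σ ⟨$⟩ˡ (σ ⟨$⟩ʳ Fin.suc (π ⟨$⟩ˡ k))           ≡⟨ Perm.inverseˡ σ ⟩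
      Fin.suc (π ⟨$⟩ˡ k)                           ∎)

  -- Avoidance of 231

  -- LowFirst p π says that in π the values below p come before all the others.
  LowFirst : ∀ {n} → ℕ → Permutation′ n → Set
  LowFirst p π = ∀ k j → k Fin.< j → toℕ (π ⟨$⟩ʳ j) < p → toℕ (π ⟨$⟩ʳ k) < p

  lowFirst⇔splits : ∀ {n p} {π : Permutation′ n} {c} → Represents π c → p ≤ n → LowFirst p π ⇔ T (splits p c)
  lowFirst⇔splits {p = zero} r p≤n = mk⇔ (λ _ → tt) (λ _ _ _ _ ())
  lowFirst⇔splits {p = suc p} (_∷_ {n} {π} {c} i r) (s≤s p≤n) = mk⇔ to from
    where
    σ = insert 0F i π
    module IH = Equivalence (lowFirst⇔splits {p = p} r p≤n)

    to : LowFirst (suc p) σ → T (splits (suc p) (toℕ i ∷ c))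
    to low = Equivalence.from (T-∧ {x = toℕ i <ᵇ suc p}) (<⇒<ᵇ i<1+p , IH.to low′)
      where
      -- The value 0 occurs somewhere, so that LowFirst applies to position 0
      -- unless 0 is the initial value itself.
      i<1+p : toℕ i < suc p
      i<1+p with σ ⟨$⟩ˡ 0F | Perm.inverseʳ σ {0F}
      ... | Fin.zero  | e = subst (λ v → toℕ v < suc p) (sym e) (s≤s z≤n)
      ... | Fin.suc j | e = low 0F (Fin.suc j) (s≤s z≤n) (subst (λ v → toℕ v < suc p) (sym e) (s≤s z≤n))
      low′ : LowFirst p π
      low′ k j k<j πj<p = punch-below⁻ (s≤s⁻¹ i<1+p) (subst (_< suc p) (toℕ-punchIn i (π ⟨$⟩ʳ k))
        (low (Fin.suc k) (Fin.suc j) (s≤s k<j)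
          (subst (_< suc p) (sym (toℕ-punchIn i (π ⟨$⟩ʳ j))) (punch-below (s≤s⁻¹ i<1+p) πj<p))))

    from : T (splits (suc p) (toℕ i ∷ c)) → LowFirst (suc p) σ
    from t k j k<j σj<1+p with Equivalence.to (T-∧ {x = toℕ i <ᵇ suc p}) t
    from t Fin.zero    j           k<j       σj<1+p | i<ᵇ , s = <ᵇ⇒< (toℕ i) (suc p) i<ᵇ
    from t (Fin.suc k) (Fin.suc j) (s≤s k<j) σj<1+p | i<ᵇ , s =
      subst (_< suc p) (sym (toℕ-punchIn i (π ⟨$⟩ʳ k))) (punch-below i≤p (IH.from s k j k<j
        (punch-below⁻ i≤p (subst (_< suc p) (toℕ-punchIn i (π ⟨$⟩ʳ j)) σj<1+p))))
      where
      i≤p : toℕ i ≤ p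
      i≤p = s≤s⁻¹ (<ᵇ⇒< (toℕ i) (suc p) i<ᵇ)

  -- The patterns 231 whose 2 is the initial value i are the violations of
  -- LowFirst i.
  avoids231-insert : ∀ {n} (i : Fin (suc n)) (π : Permutation′ n) →
                     Avoids231 (insert 0F i π) ⇔ (LowFirst (toℕ i) π × Avoids231 π)
  avoids231-insert i π = mk⇔ (λ av → low av , avoid av) from
    where
    σ = insert 0F i π
    v : ∀ k → toℕ (σ ⟨$⟩ʳ Fin.suc k) ≡ punch (toℕ i) (toℕ (π ⟨$⟩ʳ k))
    v k = toℕ-punchIn i (π ⟨$⟩ʳ k)

    low : Avoids231 σ → LowFirst (toℕ i) π
    low av k j k<j πj<i with toℕ (π ⟨$⟩ʳ k) <? toℕ i
    ... | yes πk<i = πk<i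
    ... | no  πk≮i = contradiction
      ( subst (_< toℕ i) (sym (trans (v j) (punch-< πj<i))) πj<i
      , subst (toℕ i <_) (sym (trans (v k) (punch-≥ (≮⇒≥ πk≮i)))) (s≤s (≮⇒≥ πk≮i)))
      (av 0F (Fin.suc k) (Fin.suc j) (s≤s z≤n) (s≤s k<j))

    avoid : Avoids231 σ → Avoids231 π
    avoid av a b c a<b b<c (πc<πa , πa<πb) =
      av (Fin.suc a) (Fin.suc b) (Fin.suc c) (s≤s a<b) (s≤s b<c)
        ( subst₂ _<_ (sym (v c)) (sym (v a)) (punch-mono (toℕ i) πc<πa)
        , subst₂ _<_ (sym (v a)) (sym (v b)) (punch-mono (toℕ i) πa<πb))

    from : LowFirst (toℕ i) π × Avoids231 π → Avoids231 σ
    from (lo , av) Fin.zero (Fin.suc b) (Fin.suc c) _ (s≤s b<c) (σc<i , i<σb) =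
      <⇒≱ (lo b c b<c (punch-low⁻ (subst (_< toℕ i) (v c) σc<i)))
          (punch-high⁻ (subst (toℕ i <_) (v b) i<σb))
    from (lo , av) (Fin.suc a) (Fin.suc b) (Fin.suc c) (s≤s a<b) (s≤s b<c) (σc<σa , σa<σb) =
      av a b c a<b b<c
        ( punch-cancel (toℕ i) (subst₂ _<_ (v c) (v a) σc<σa)
        , punch-cancel (toℕ i) (subst₂ _<_ (v a) (v b) σa<σb))

  avoids231⇔avoids : ∀ {n} {σ : Permutation′ n} {c} → Represents σ c → Avoids231 σ ⇔ T (avoids c)
  avoids231⇔avoids [] = mk⇔ (λ _ → tt) (λ _ ())
  avoids231⇔avoids (_∷_ {π = π} {c = c} i r) = mk⇔
    (λ av → let (lo , av′) = Ins.to av in Equivalence.from (T-∧ {x = splits (toℕ i) c}) (Lo.to lo , IH.to av′))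
    (λ t → let (s , t′) = Equivalence.to (T-∧ {x = splits (toℕ i) c}) t in Ins.from (Lo.from s , IH.from t′))
    where
    module Ins = Equivalence (avoids231-insert i π)
    module Lo  = Equivalence (lowFirst⇔splits {p = toℕ i} r (Fin.toℕ≤pred[n] i))
    module IH  = Equivalence (avoids231⇔avoids r)

  avoids231?-code : ∀ {n} {σ : Permutation′ n} {c} → Represents σ c → does (avoids231? σ) ≡ avoids c
  avoids231?-code {σ = σ} {c} r = does-⇔ (avoids231⇔avoids r) (avoids231? σ) (T? (avoids c))

  -- The major index and the ascents

  -- The sum of the descent positions of a list, counted from i + 1 on.
  desc : ℕ → List ℕ → ℕ
  desc i []          = 0
  desc i (x ∷ [])    = 0
  desc i (x ∷ y ∷ l) = (if y <ᵇ x then suc i else 0) + desc (suc i) (y ∷ l)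

  -- The sum of the positions filtered from an enumeration h is the descent sum of
  -- f, if the predicate holds where f descends.
  sum-filter-tabulate : ∀ {A : Set} {P : A → Set} (P? : ∀ x → Dec (P x)) (w : A → ℕ) {m} b
    (f : Fin (suc m) → ℕ) (h : Fin m → A) →
    (∀ i → w (h i) ≡ suc (b + toℕ i)) → (∀ i → does (P? (h i)) ≡ (f (Fin.suc i) <ᵇ f (inject₁ i))) →
    sum (map w (filter P? (tabulate h))) ≡ desc b (tabulate f)
  sum-filter-tabulate P? w {zero}  b f h wh Ph = refl
  sum-filter-tabulate P? w {suc m} b f h wh Ph
    rewrite sym (Ph 0F)
    with does (P? (h 0F)) | sum-filter-tabulate P? w (suc b) (f ∘ Fin.suc) (h ∘ Fin.suc)
           (λ i → trans (wh (Fin.suc i)) (cong suc (+-suc b (toℕ i)))) (Ph ∘ Fin.suc)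
  ... | true  | ih = cong₂ _+_ (trans (wh 0F) (cong suc (+-identityʳ b))) ih
  ... | false | ih = ih

  -- Every position b + 1, …, b + m is either a descent or an ascent, and these
  -- positions sum to m b + (m + 1) C 2.
  desc+asc : ∀ m b (f : Fin (suc m) → ℕ) → (∀ i → f (inject₁ i) ≢ f (Fin.suc i)) →
             desc b (tabulate f) + asc b (tabulate f) ≡ m * b + (suc m C 2)
  desc+asc zero    b f p = refl
  desc+asc (suc m) b f p = begin
    (d + D) + (u + A)                    ≡⟨ shuffle d D u A ⟩
    (d + u) + (D + A)                    ≡⟨ cong₂ _+_ one-of (desc+asc m (suc b) (f ∘ Fin.suc) (p ∘ Fin.suc)) ⟩
    suc b + (m * suc b + (suc m C 2))    ≡⟨ arith b m (suc m C 2) ⟩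
    suc m * b + (suc m + (suc m C 2))    ≡⟨ cong (λ k → suc m * b + (k + (suc m C 2))) (nC1≡n (suc m)) ⟨
    suc m * b + ((suc m C 1) + (suc m C 2)) ≡⟨ cong (suc m * b +_) (nCk+nC[k+1]≡[n+1]C[k+1] (suc m) 1) ⟩
    suc m * b + (suc (suc m) C 2)        ∎
    where
    x = f 0F
    y = f (Fin.suc 0F)
    d = if y <ᵇ x then suc b else 0
    u = if x <ᵇ y then suc b else 0
    D = desc (suc b) (tabulate (f ∘ Fin.suc))
    A = asc  (suc b) (tabulate (f ∘ Fin.suc))
    shuffle : ∀ d D u A → (d + D) + (u + A) ≡ (d + u) + (D + A)
    shuffle = NS.solve-∀
    arith : ∀ b m c → suc b + (m * suc b + c) ≡ suc m * b + (suc m + c)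
    arith = NS.solve-∀
    one-of : d + u ≡ suc b
    one-of with <-cmp x y
    ... | tri< x<y _ _ rewrite <ᵇ-true x<y | <ᵇ-false (<⇒≤ x<y) = refl
    ... | tri≈ _ x≡y _ = contradiction x≡y (p 0F)
    ... | tri> _ _ y<x rewrite <ᵇ-true y<x | <ᵇ-false (<⇒≤ y<x) = +-identityʳ (suc b)

  maj+asc : ∀ {n} (σ : Permutation′ n) → maj σ + asc 0 (tabulate (toℕ ∘ (σ ⟨$⟩ʳ_))) ≡ n C 2
  maj+asc {zero}  σ = refl
  maj+asc {suc m} σ = begin
    maj σ + asc 0 (tabulate f)
      ≡⟨ cong (_+ asc 0 (tabulate f)) (sum-filter-tabulate _ (λ i → suc (toℕ i)) 0 f id (λ _ → refl) (λ _ → refl)) ⟩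
    desc 0 (tabulate f) + asc 0 (tabulate f)   ≡⟨ desc+asc m 0 f distinct ⟩
    m * 0 + (suc m C 2)                        ≡⟨ cong (_+ (suc m C 2)) (*-zeroʳ m) ⟩
    suc m C 2                                  ∎
    where
    f : Fin (suc m) → ℕ
    f k = toℕ (σ ⟨$⟩ʳ k)
    distinct : ∀ i → f (inject₁ i) ≢ f (Fin.suc i)
    distinct i e = <⇒≢ (≤-reflexive (cong suc (Fin.toℕ-inject₁ i)))
      (cong toℕ (injective (Fin.toℕ-injective e)))
      where
      injective : ∀ {k l} → σ ⟨$⟩ʳ k ≡ σ ⟨$⟩ʳ l → k ≡ l
      injective e = trans (sym (Perm.inverseˡ σ)) (trans (cong (σ ⟨$⟩ˡ_) e) (Perm.inverseˡ σ))

-- Sums over lists, permutations and codes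
module ListSums {c ℓ} (R : CommutativeRing c ℓ) where
  open CommutativeRing R hiding (zero)
  open Sums R
  open Codes
  open import Relation.Binary.Reasoning.Setoid setoid

  -- The product with an indicator.
  when : Bool → Carrier → Carrier
  when true  x = x
  when false x = 0#

  when-cong : ∀ b {x y} → x ≈ y → when b x ≈ when b y
  when-cong true  p = p
  when-cong false p = refl

  when-≡ : ∀ {b b′} x → b ≡ b′ → when b x ≈ when b′ x
  when-≡ x e = reflexive (≡.cong (λ b → when b x) e)

  when-*ˡ : ∀ b x y → when b (x * y) ≈ x * when b y
  when-*ˡ true  x y = refl
  when-*ˡ false x y = sym (zeroʳ x)

  when-∧ : ∀ b b′ x → when (b ∧ b′) x ≈ when b (when b′ x)
  when-∧ true  b′ x = refl
  when-∧ false b′ x = refl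

  when-* : ∀ b b′ x y → when (b ∧ b′) (x * y) ≈ when b x * when b′ y
  when-* true  true  x y = refl
  when-* true  false x y = sym (zeroʳ x)
  when-* false b′    x y = sym (zeroˡ _)

  sumOver-cong : ∀ {A : Set} (xs : List A) {f g : A → Carrier} → (∀ x → f x ≈ g x) →
                 sumOver R xs f ≈ sumOver R xs g
  sumOver-cong []       p = refl
  sumOver-cong (x ∷ xs) p = +-cong (p x) (sumOver-cong xs p)

  sumOver-++ : ∀ {A : Set} (xs ys : List A) (f : A → Carrier) →
               sumOver R (xs ++ ys) f ≈ sumOver R xs f + sumOver R ys f
  sumOver-++ []       ys f = sym (+-identityˡ _)
  sumOver-++ (x ∷ xs) ys f = trans (+-congˡ (sumOver-++ xs ys f)) (sym (+-assoc _ _ _))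

  sumOver-map : ∀ {A B : Set} (h : A → B) (xs : List A) (f : B → Carrier) →
                sumOver R (map h xs) f ≈ sumOver R xs (f ∘ h)
  sumOver-map h []       f = refl
  sumOver-map h (x ∷ xs) f = +-congˡ (sumOver-map h xs f)

  sumOver-cartesian : ∀ {A B C : Set} (h : A → B → C) (xs : List A) (ys : List B) (f : C → Carrier) →
    sumOver R (cartesianProductWith h xs ys) f ≈ sumOver R xs (λ x → sumOver R ys (λ y → f (h x y)))
  sumOver-cartesian h []       ys f = refl
  sumOver-cartesian h (x ∷ xs) ys f =
    trans (sumOver-++ (map (h x) ys) _ f) (+-cong (sumOver-map (h x) ys f) (sumOver-cartesian h xs ys f))

  sumOver-filter : ∀ {A : Set} {P : A → Set} (P? : ∀ x → Dec (P x)) (xs : List A) (f : A → Carrier) →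
    sumOver R (filter P? xs) f ≈ sumOver R xs (λ x → when (does (P? x)) (f x))
  sumOver-filter P? []       f = refl
  sumOver-filter P? (x ∷ xs) f with does (P? x)
  ... | true  = +-congˡ (sumOver-filter P? xs f)
  ... | false = trans (sumOver-filter P? xs f) (sym (+-identityˡ _))

  sumOver-tabulate : ∀ n {A : Set} (h : Fin (suc n) → A) (f : A → Carrier) (F : ℕ → Carrier) →
    (∀ i → f (h i) ≈ F (toℕ i)) → sumOver R (tabulate h) f ≈ conv n (λ i _ → F i)
  sumOver-tabulate zero    h f F p = trans (+-identityʳ _) (p 0F)
  sumOver-tabulate (suc n) h f F p = +-cong (p 0F) (sumOver-tabulate n (h ∘ Fin.suc) f (F ∘ suc) (p ∘ Fin.suc))

  -- The sum over all codes of size n.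
  sumCodes : ℕ → (List ℕ → Carrier) → Carrier
  sumCodes zero    f = f []
  sumCodes (suc n) f = conv n (λ i _ → sumCodes n (λ c → f (i ∷ c)))

  sumCodes-cong : ∀ n {f g : List ℕ → Carrier} → (∀ c → Code n c → f c ≈ g c) → sumCodes n f ≈ sumCodes n g
  sumCodes-cong zero    p = p [] []
  sumCodes-cong (suc n) p = conv-cong n λ i t i+t≡n → sumCodes-cong n λ c cc →
    p (i ∷ c) (ℕ.m+n≤o⇒m≤o i (ℕ.≤-reflexive i+t≡n) ∷ cc)

  sumCodes-0 : ∀ n → sumCodes n (λ _ → 0#) ≈ 0#
  sumCodes-0 zero    = refl
  sumCodes-0 (suc n) = trans (conv-cong n λ _ _ _ → sumCodes-0 n) (conv-0 n)

  sumCodes-*ˡ : ∀ n x (f : List ℕ → Carrier) → sumCodes n (λ c → x * f c) ≈ x * sumCodes n f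
  sumCodes-*ˡ zero    x f = refl
  sumCodes-*ˡ (suc n) x f = trans (conv-cong n λ _ _ _ → sumCodes-*ˡ n x _) (conv-* n x _)

  sumCodes-when : ∀ n b (f : List ℕ → Carrier) → sumCodes n (λ c → when b (f c)) ≈ when b (sumCodes n f)
  sumCodes-when n true  f = refl
  sumCodes-when n false f = sumCodes-0 n

  sumCodes-product : ∀ m n (f g : List ℕ → Carrier) →
    sumCodes m (λ c → sumCodes n (λ d → f c * g d)) ≈ sumCodes m f * sumCodes n g
  sumCodes-product m n f g = begin
    sumCodes m (λ c → sumCodes n (λ d → f c * g d))
      ≈⟨ sumCodes-cong m (λ c _ → trans (sumCodes-*ˡ n (f c) g) (*-comm _ _)) ⟩
    sumCodes m (λ c → sumCodes n g * f c)     ≈⟨ sumCodes-*ˡ m _ f ⟩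
    sumCodes n g * sumCodes m f               ≈⟨ *-comm _ _ ⟩
    sumCodes m f * sumCodes n g               ∎

  conv-truncate : ∀ p m (F : ℕ → Carrier) →
    conv (p ℕ.+ m) (λ i _ → when (i <ᵇ suc p) (F i)) ≈ conv p (λ i _ → F i)
  conv-truncate zero    zero    F = refl
  conv-truncate zero    (suc m) F = trans (+-congˡ (conv-0 m)) (+-identityʳ _)
  conv-truncate (suc p) m       F = +-congˡ (conv-truncate p m (F ∘ suc))

  -- A code that splits at p is the concatenation of a code of size p and another.
  sumCodes-split : ∀ p m (f : List ℕ → Carrier) →
    sumCodes (p ℕ.+ m) (λ c → when (splits p c) (f c)) ≈
    sumCodes p (λ c → sumCodes m (λ d → f (c ++ d)))
  sumCodes-split zero    m f = refl
  sumCodes-split (suc p) m f = begin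
    conv (p ℕ.+ m) (λ i _ → sumCodes (p ℕ.+ m) (λ c → when ((i <ᵇ suc p) ∧ splits p c) (f (i ∷ c))))
      ≈⟨ conv-cong (p ℕ.+ m) (λ i _ _ → trans
           (sumCodes-cong (p ℕ.+ m) (λ c _ → when-∧ (i <ᵇ suc p) (splits p c) (f (i ∷ c))))
           (sumCodes-when (p ℕ.+ m) (i <ᵇ suc p) _)) ⟩
    conv (p ℕ.+ m) (λ i _ → when (i <ᵇ suc p) (sumCodes (p ℕ.+ m) (λ c → when (splits p c) (f (i ∷ c)))))
      ≈⟨ conv-truncate p m _ ⟩
    conv p (λ i _ → sumCodes (p ℕ.+ m) (λ c → when (splits p c) (f (i ∷ c))))
      ≈⟨ conv-cong p (λ i _ _ → sumCodes-split p m (λ c → f (i ∷ c))) ⟩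
    conv p (λ i _ → sumCodes p (λ c → sumCodes m (λ d → f (i ∷ c ++ d)))) ∎

  sum-permutations : ∀ n {F : Permutation′ n → Carrier} {G : List ℕ → Carrier} →
    (∀ σ c → Represents σ c → F σ ≈ G c) → sumOver R (permutations n) F ≈ sumCodes n G
  sum-permutations zero    p = trans (+-identityʳ _) (p Perm.id [] [])
  sum-permutations (suc n) {F} {G} p = begin
    sumOver R (cartesianProductWith (insert 0F) (allFin (suc n)) (permutations n)) F
      ≈⟨ sumOver-cartesian (insert 0F) (allFin (suc n)) (permutations n) F ⟩
    sumOver R (allFin (suc n)) (λ i → sumOver R (permutations n) (λ π → F (insert 0F i π)))
      ≈⟨ sumOver-tabulate n _ _ (λ i → sumCodes n (λ c → G (i ∷ c)))
           (λ i → sum-permutations n (λ π c r → p (insert 0F i π) (toℕ i ∷ c) (i ∷ r))) ⟩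
    conv n (λ i _ → sumCodes n (λ c → G (i ∷ c))) ∎

-- 231-avoiding permutations by ascents
module Permutations {c ℓ} (R : CommutativeRing c ℓ) (z : CommutativeRing.Carrier R) where
  open CommutativeRing R hiding (zero)
  open Sums R
  open ListSums R
  open Codes
  open Gauss R z
  open Paths R z
  import Algebra.Properties.Semiring.Exp semiring as Exp
  open Exp using (_^_)
  open import Relation.Binary.Reasoning.Setoid setoid

  -- The ascents of a permutation and of its inverse, with positions counted from
  -- i + 1 and j + 1 on.
  weight : ℕ → ℕ → List ℕ → Carrier
  weight i j c = z^ (asc i (values c) ℕ.+ asc j (inverse c))

  -- The same for the permutation as an upper block that follows lower blocks
  -- ending at positions i and j.
  upperWeight : ℕ → ℕ → List ℕ → Carrier
  upperWeight i j c = z^ (upper i (values c) ℕ.+ upper j (inverse c))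

  -- The sum of the weights of the 231-avoiding permutations of size n.
  avoiderSum : ℕ → ℕ → ℕ → Carrier
  avoiderSum n i j = sumCodes n (λ c → when (avoids c) (weight i j c))

  upperSum : ℕ → ℕ → ℕ → Carrier
  upperSum n i j = sumCodes n (λ c → when (avoids c) (upperWeight i j c))

  weight-block : ∀ {p c} i j d → Code p c →
    weight i j (p ∷ c ++ d) ≈ weight (suc i) j c * upperWeight (i ℕ.+ suc p) (j ℕ.+ suc p) d
  weight-block {p} {c} i j d cc = begin
    weight i j (p ∷ c ++ d)
      ≈⟨ z^≡ (≡.cong₂ ℕ._+_ (asc-values-block i d cc) (asc-inverse-block j d cc)) ⟩
    z^ ((a₁ ℕ.+ u₁) ℕ.+ (a₂ ℕ.+ u₂))   ≈⟨ z^≡ (shuffle a₁ u₁ a₂ u₂) ⟩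
    z^ ((a₁ ℕ.+ a₂) ℕ.+ (u₁ ℕ.+ u₂))   ≈⟨ z^+ (a₁ ℕ.+ a₂) (u₁ ℕ.+ u₂) ⟩
    weight (suc i) j c * upperWeight (i ℕ.+ suc p) (j ℕ.+ suc p) d ∎
    where
    a₁ u₁ a₂ u₂ : ℕ
    a₁ = asc (suc i) (values c)
    u₁ = upper (i ℕ.+ suc p) (values d)
    a₂ = asc j (inverse c)
    u₂ = upper (j ℕ.+ suc p) (inverse d)
    shuffle : ∀ a u b v → (a ℕ.+ u) ℕ.+ (b ℕ.+ v) ≡ (a ℕ.+ b) ℕ.+ (u ℕ.+ v)
    shuffle = NS.solve-∀

  avoiderSum-suc : ∀ n i j → avoiderSum (suc n) i j ≈
          conv n (λ p m → avoiderSum p (suc i) j * upperSum m (i ℕ.+ suc p) (j ℕ.+ suc p))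
  avoiderSum-suc n i j = conv-cong n λ { p m ≡.refl → begin
    sumCodes (p ℕ.+ m) (λ c → when (splits p c ∧ avoids c) (weight i j (p ∷ c)))
      ≈⟨ sumCodes-cong (p ℕ.+ m) (λ c _ → when-∧ (splits p c) (avoids c) _) ⟩
    sumCodes (p ℕ.+ m) (λ c → when (splits p c) (when (avoids c) (weight i j (p ∷ c))))
      ≈⟨ sumCodes-split p m (λ c → when (avoids c) (weight i j (p ∷ c))) ⟩
    sumCodes p (λ c → sumCodes m (λ d → when (avoids (c ++ d)) (weight i j (p ∷ c ++ d))))
      ≈⟨ sumCodes-cong p (λ c cc → sumCodes-cong m (λ d _ → factor p c cc d)) ⟩
    sumCodes p (λ c → sumCodes m (λ d → when (avoids c) (weight (suc i) j c)
                                       * when (avoids d) (upperWeight (i ℕ.+ suc p) (j ℕ.+ suc p) d)))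
      ≈⟨ sumCodes-product p m _ _ ⟩
    avoiderSum p (suc i) j * upperSum m (i ℕ.+ suc p) (j ℕ.+ suc p) ∎ }
    where
    factor : ∀ p c → Code p c → ∀ d → when (avoids (c ++ d)) (weight i j (p ∷ c ++ d)) ≈
             when (avoids c) (weight (suc i) j c) * when (avoids d) (upperWeight (i ℕ.+ suc p) (j ℕ.+ suc p) d)
    factor p c cc d = begin
      when (avoids (c ++ d)) (weight i j (p ∷ c ++ d))
        ≈⟨ when-≡ _ (avoids-++ cc d) ⟩
      when (avoids c ∧ avoids d) (weight i j (p ∷ c ++ d))
        ≈⟨ when-cong (avoids c ∧ avoids d) (weight-block i j d cc) ⟩
      when (avoids c ∧ avoids d) (weight (suc i) j c * upperWeight (i ℕ.+ suc p) (j ℕ.+ suc p) d)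
        ≈⟨ when-* (avoids c) (avoids d) _ _ ⟩
      _ ∎

  upper-nonempty : ∀ i {n} xs → length xs ≡ suc n → upper i xs ≡ i ℕ.+ asc i xs
  upper-nonempty i (x ∷ xs) _ = ≡.refl

  upperSum-suc : ∀ n i j → upperSum (suc n) i j ≈ z^ (i ℕ.+ j) * avoiderSum (suc n) i j
  upperSum-suc n i j = begin
    sumCodes (suc n) (λ c → when (avoids c) (upperWeight i j c))
      ≈⟨ sumCodes-cong (suc n) (λ c cc → trans (when-cong (avoids c) (weights c cc)) (when-*ˡ (avoids c) _ _)) ⟩
    sumCodes (suc n) (λ c → z^ (i ℕ.+ j) * when (avoids c) (weight i j c))
      ≈⟨ sumCodes-*ˡ (suc n) (z^ (i ℕ.+ j)) (λ c → when (avoids c) (weight i j c)) ⟩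
    z^ (i ℕ.+ j) * avoiderSum (suc n) i j ∎
    where
    shuffle : ∀ i a j b → (i ℕ.+ a) ℕ.+ (j ℕ.+ b) ≡ (i ℕ.+ j) ℕ.+ (a ℕ.+ b)
    shuffle = NS.solve-∀
    weights : ∀ c → Code (suc n) c → upperWeight i j c ≈ z^ (i ℕ.+ j) * weight i j c
    weights c cc = begin
      upperWeight i j c
        ≈⟨ z^≡ (≡.cong₂ ℕ._+_ (upper-nonempty i (values c) (length-values cc))
                              (upper-nonempty j (inverse c) (length-inverse cc))) ⟩
      z^ ((i ℕ.+ asc i (values c)) ℕ.+ (j ℕ.+ asc j (inverse c)))
        ≈⟨ z^≡ (shuffle i (asc i (values c)) j (asc j (inverse c))) ⟩
      z^ ((i ℕ.+ j) ℕ.+ (asc i (values c) ℕ.+ asc j (inverse c)))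
        ≈⟨ z^+ (i ℕ.+ j) _ ⟩
      z^ (i ℕ.+ j) * weight i j c ∎

  -- Both sides satisfy the same recursion, by avoiderSum-suc and first-return.  The
  -- induction is on the bound B of n.  On the right only the sum i + j matters, as
  -- a valley at (x, y) of a path has the single position x + y.
  avoiderSum≈dyck-≤ : ∀ B n i j → n ≤ B → avoiderSum n i j ≈ dyck false 0 n (i ℕ.+ j)
  avoiderSum≈dyck-≤ B zero    i j _ = refl
  avoiderSum≈dyck-≤ (suc B) (suc n) i j (s≤s n≤B) = begin
    avoiderSum (suc n) i j  ≈⟨ avoiderSum-suc n i j ⟩
    conv n (λ p m → avoiderSum p (suc i) j * upperSum m (i ℕ.+ suc p) (j ℕ.+ suc p))
      ≈⟨ conv-cong n (λ p m p+m≡n → *-cong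
           (avoiderSum≈dyck-≤ B p (suc i) j (ℕ.≤-trans (ℕ.m+n≤o⇒m≤o p (ℕ.≤-reflexive p+m≡n)) n≤B))
           (trans (upperPart m (i ℕ.+ suc p) (j ℕ.+ suc p) (ℕ.≤-trans (ℕ.m+n≤o⇒n≤o p (ℕ.≤-reflexive p+m≡n)) n≤B))
                  (dyck-≡ true 0 m (index i j p)))) ⟩
    conv n (λ p m → dyck false 0 p (suc (i ℕ.+ j)) * dyck true 0 m (suc (suc (i ℕ.+ j) ℕ.+ (p ℕ.+ p))))
      ≈⟨ first-return n (i ℕ.+ j) ⟨
    dyck false 0 (suc n) (i ℕ.+ j) ∎
    where
    index : ∀ i j p → (i ℕ.+ suc p) ℕ.+ (j ℕ.+ suc p) ≡ suc (suc (i ℕ.+ j) ℕ.+ (p ℕ.+ p))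
    index = NS.solve-∀
    upperPart : ∀ m i j → m ≤ B → upperSum m i j ≈ dyck true 0 m (i ℕ.+ j)
    upperPart zero    i j _   = refl
    upperPart (suc m) i j m<B = begin
      upperSum (suc m) i j                             ≈⟨ upperSum-suc m i j ⟩
      z^ (i ℕ.+ j) * avoiderSum (suc m) i j               ≈⟨ *-congˡ (avoiderSum≈dyck-≤ B (suc m) i j m<B) ⟩
      z^ (i ℕ.+ j) * dyck false 0 (suc m) (i ℕ.+ j) ≈⟨ *-congˡ (*-identityˡ _) ⟩
      dyck true 0 (suc m) (i ℕ.+ j)              ∎

  𝒜-closed : ∀ n q → q * z ≈ 1# → 𝒜 R n q z ≈ q ^ (n C 2) * H n 1
  𝒜-closed n q qz = begin
    𝒜 R n q z
      ≈⟨ sumOver-filter avoids231? (permutations n) _ ⟩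
    sumOver R (permutations n) (λ σ → when (does (avoids231? σ)) (q ^ maj σ * z^ (n C 2 ∸ imaj σ)))
      ≈⟨ sum-permutations n term ⟩
    sumCodes n (λ c → q ^ (n C 2) * when (avoids c) (weight 0 0 c))
      ≈⟨ sumCodes-*ˡ n _ _ ⟩
    q ^ (n C 2) * avoiderSum n 0 0       ≈⟨ *-congˡ (trans (avoiderSum≈dyck-≤ n n 0 0 ℕ.≤-refl) (dyck-closed n)) ⟩
    q ^ (n C 2) * H n 1         ∎
    where
    term : ∀ σ c → Represents σ c → when (does (avoids231? σ)) (q ^ maj σ * z^ (n C 2 ∸ imaj σ))
           ≈ q ^ (n C 2) * when (avoids c) (weight 0 0 c)
    term σ c r = trans (when-≡ _ (avoids231?-code r)) (trans (when-cong (avoids c) (begin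
      q ^ maj σ * z^ (n C 2 ∸ imaj σ)
        ≈⟨ *-cong (z^-complement qz (maj σ) (asc 0 (values c))) (z^≡ imaj-complement) ⟩
      q ^ (maj σ ℕ.+ asc 0 (values c)) * z^ asc 0 (values c) * z^ asc 0 (inverse c)
        ≈⟨ *-assoc _ _ _ ⟩
      q ^ (maj σ ℕ.+ asc 0 (values c)) * (z^ asc 0 (values c) * z^ asc 0 (inverse c))
        ≈⟨ *-cong (Exp.^-congʳ q maj-complement) (sym (z^+ (asc 0 (values c)) _)) ⟩
      q ^ (n C 2) * weight 0 0 c ∎)) (when-*ˡ (avoids c) _ _))
      where
      maj-complement : maj σ ℕ.+ asc 0 (values c) ≡ n C 2
      maj-complement = ≡.trans (≡.cong (λ xs → maj σ ℕ.+ asc 0 xs) (≡.sym (values-correct r))) (maj+asc σ)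
      imaj-complement : n C 2 ∸ imaj σ ≡ asc 0 (inverse c)
      imaj-complement = ≡.trans
        (≡.cong (_∸ imaj σ) (≡.sym (≡.trans
          (≡.cong (λ xs → imaj σ ℕ.+ asc 0 xs) (≡.sym (inverse-correct r))) (maj+asc (flip σ)))))
        (ℕ.m+n∸m≡n (imaj σ) _)

-- Ballot words, their rows and their bounce paths
module Words where
  open ≡ hiding ([_])
  open ≡-Reasoning

  #0-north : ∀ w → #0 (w ∷ʳ 0F) ≡ suc (#0 w)
  #0-north []       = refl
  #0-north (0F ∷ w) = cong suc (#0-north w)
  #0-north (1F ∷ w) = #0-north w

  #0-east : ∀ w → #0 (w ∷ʳ 1F) ≡ #0 w
  #0-east []       = refl
  #0-east (0F ∷ w) = cong suc (#0-east w)
  #0-east (1F ∷ w) = #0-east w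

  #1-north : ∀ w → #1 (w ∷ʳ 0F) ≡ #1 w
  #1-north []       = refl
  #1-north (0F ∷ w) = #1-north w
  #1-north (1F ∷ w) = cong suc (#1-north w)

  #1-east : ∀ w → #1 (w ∷ʳ 1F) ≡ suc (#1 w)
  #1-east []       = refl
  #1-east (0F ∷ w) = #1-east w
  #1-east (1F ∷ w) = cong suc (#1-east w)

  inits-∷ʳ : ∀ {A : Set} (xs : List A) x → inits (xs ∷ʳ x) ≡ inits xs ∷ʳ (xs ∷ʳ x)
  inits-∷ʳ []       x = refl
  inits-∷ʳ (y ∷ xs) x = cong ([] ∷_) (trans (cong (map (y ∷_)) (inits-∷ʳ xs x)) (map-++ (y ∷_) (inits xs) _))

  All-inits-last : ∀ {A : Set} {P : List A → Set} xs → All P (inits xs) → P xs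
  All-inits-last []       (p ∷ []) = p
  All-inits-last (x ∷ xs) (_ ∷ ps) = All-inits-last xs (All.map⁻ ps)

  -- Ballot words with m north and n east steps; IsBallot n n is IsDyck n by
  -- definition.
  IsBallot : ℕ → ℕ → Word → Set
  IsBallot m n w = #0 w ≡ m × #1 w ≡ n × All (λ p → #1 p ≤ #0 p) (inits w)

  isBallot? : ∀ m n w → Dec (IsBallot m n w)
  isBallot? m n w = (#0 w ℕ.≟ m) ×-dec ((#1 w ℕ.≟ n) ×-dec all? (λ p → #1 p ℕ.≤? #0 p) (inits w))

  ballot-north⇔ : ∀ m n w → IsBallot (suc m) n (w ∷ʳ 0F) ⇔ IsBallot m n w
  ballot-north⇔ m n w = mk⇔
    (λ (z0 , o , ps) → ℕ.suc-injective (trans (sym (#0-north w)) z0) , trans (sym (#1-north w)) o ,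
      proj₁ (All.∷ʳ⁻ (subst (All _) (inits-∷ʳ w 0F) ps)))
    (λ (z0 , o , ps) → trans (#0-north w) (cong suc z0) , trans (#1-north w) o ,
      subst (All _) (sym (inits-∷ʳ w 0F)) (All.∷ʳ⁺ ps
        (subst₂ _≤_ (sym (#1-north w)) (sym (#0-north w)) (ℕ.m≤n⇒m≤1+n (All-inits-last w ps)))))

  ballot-east⇔ : ∀ m n w → IsBallot m (suc n) (w ∷ʳ 1F) ⇔ (n < m × IsBallot m n w)
  ballot-east⇔ m n w = mk⇔
    (λ (z0 , o , ps) → let (qs , q) = All.∷ʳ⁻ (subst (All _) (inits-∷ʳ w 1F) ps) in
      subst₂ _≤_ o z0 q ,
      trans (sym (#0-east w)) z0 , ℕ.suc-injective (trans (sym (#1-east w)) o) , qs)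
    (λ (n<m , z0 , o , ps) → trans (#0-east w) z0 , trans (#1-east w) (cong suc o) ,
      subst (All _) (sym (inits-∷ʳ w 1F)) (All.∷ʳ⁺ ps
        (subst₂ _≤_ (sym (trans (#1-east w) (cong suc o))) (sym (trans (#0-east w) z0)) n<m)))

  north≢0 : ∀ n w → ¬ IsBallot 0 n (w ∷ʳ 0F)
  north≢0 n w (z0 , _) = contradiction (trans (sym (#0-north w)) z0) λ ()

  east≢0 : ∀ m w → ¬ IsBallot m 0 (w ∷ʳ 1F)
  east≢0 m w (_ , o , _) = contradiction (trans (sym (#1-east w)) o) λ ()

  -- The same words, generated by their last letters.  Only an east step can
  -- violate the ballot condition.
  data Ballot : ℕ → ℕ → Word → Set where
    []     : Ballot 0 0 []
    north  : ∀ {m n w} → Ballot m n w → Ballot (suc m) n (w ∷ʳ 0F)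
    east   : ∀ {m n w} → n < m → Ballot m n w → Ballot m (suc n) (w ∷ʳ 1F)

  Ballot-#0 : ∀ {m n w} → Ballot m n w → #0 w ≡ m
  Ballot-#0 []                   = refl
  Ballot-#0 (north {w = w} b)    = trans (#0-north w) (cong suc (Ballot-#0 b))
  Ballot-#0 (east {w = w} _ b)   = trans (#0-east w) (Ballot-#0 b)

  Ballot-#1 : ∀ {m n w} → Ballot m n w → #1 w ≡ n
  Ballot-#1 []                   = refl
  Ballot-#1 (north {w = w} b)    = trans (#1-north w) (Ballot-#1 b)
  Ballot-#1 (east {w = w} _ b)   = trans (#1-east w) (cong suc (Ballot-#1 b))

  Ballot-≤ : ∀ {m n w} → Ballot m n w → n ≤ m
  Ballot-≤ []         = z≤n
  Ballot-≤ (north b)  = ℕ.m≤n⇒m≤1+n (Ballot-≤ b)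
  Ballot-≤ (east q _) = q

  a-++ : ∀ w u y → y ≤ #0 w → a (w ++ u) y ≡ a w y
  a-++ w        u zero          _       = refl
  a-++ (0F ∷ w) u (suc zero)    _       = refl
  a-++ (0F ∷ w) u (suc (suc y)) (s≤s q) = a-++ w u (suc y) q
  a-++ (1F ∷ w) u (suc y)       q       = cong suc (a-++ w u (suc y) q)

  a-top : ∀ w → a (w ∷ʳ 0F) (suc (#0 w)) ≡ #1 w
  a-top []       = refl
  a-top (0F ∷ w) = a-top w
  a-top (1F ∷ w) = cong suc (a-top w)

  -- A north step appended to a ballot word with n east steps opens row m + 1 with
  -- a = n.
  Ballot-top : ∀ {m n w} → Ballot m n w → a (w ∷ʳ 0F) (suc m) ≡ n
  Ballot-top {m} {n} {w} b = trans (cong (λ k → a (w ∷ʳ 0F) (suc k)) (sym (Ballot-#0 b))) (trans (a-top w) (Ballot-#1 b))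

  Ballot-a : ∀ {m n w} → Ballot m n w → ∀ u y → y ≤ m → a (w ++ u) y ≡ a w y
  Ballot-a {w = w} b u y q = a-++ w u y (ℕ.≤-trans q (ℕ.≤-reflexive (sym (Ballot-#0 b))))

  Ballot-rows : ∀ {m n w} → Ballot m n w → ∀ y → y < m → a w (suc y) ≤ y
  Ballot-rows (north {m} {n} {w} b) y (s≤s y≤m) with ℕ.m≤n⇒m<n∨m≡n y≤m
  ... | inj₁ y<m  = subst (_≤ y) (sym (Ballot-a b _ (suc y) y<m)) (Ballot-rows b y y<m)
  ... | inj₂ refl = subst (_≤ y) (sym (Ballot-top b)) (Ballot-≤ b)
  Ballot-rows (east {m} {n} {w} _ b) y y<m = subst (_≤ y) (sym (Ballot-a b _ (suc y) y<m)) (Ballot-rows b y y<m)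

  -- The sum of f i over i < n.
  Σ< : ℕ → (ℕ → ℕ) → ℕ
  Σ< n f = sum (map f (upTo n))

  Σ<-suc : ∀ n f → Σ< (suc n) f ≡ Σ< n f ℕ.+ f n
  Σ<-suc n f = begin
    sum (map f (upTo (suc n)))         ≡⟨ cong (sum ∘ map f) (upTo-∷ʳ n) ⟨
    sum (map f (upTo n ∷ʳ n))          ≡⟨ cong sum (map-++ f (upTo n) _) ⟩
    sum (map f (upTo n) ++ f n ∷ [])   ≡⟨ sum-++ (map f (upTo n)) _ ⟩
    Σ< n f ℕ.+ (f n ℕ.+ 0)             ≡⟨ cong (Σ< n f ℕ.+_) (ℕ.+-identityʳ (f n)) ⟩
    Σ< n f ℕ.+ f n                     ∎

  Σ<-first : ∀ n f → Σ< (suc n) f ≡ f 0 ℕ.+ Σ< n (f ∘ suc)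
  Σ<-first n f = cong (λ xs → f 0 ℕ.+ sum xs) (trans (map-applyUpTo suc f n) (sym (map-upTo (f ∘ suc) n)))

  Σ<-cong : ∀ n {f g : ℕ → ℕ} → (∀ i → i < n → f i ≡ g i) → Σ< n f ≡ Σ< n g
  Σ<-cong zero    p = refl
  Σ<-cong (suc n) {f} {g} p = trans (Σ<-suc n f) (trans
    (cong₂ ℕ._+_ (Σ<-cong n (λ i q → p i (ℕ.m≤n⇒m≤1+n q))) (p n ℕ.≤-refl)) (sym (Σ<-suc n g)))

  Σ<-extend : ∀ c n f → c ≤ n → (∀ i → c ≤ i → f i ≡ 0) → Σ< n f ≡ Σ< c f
  Σ<-extend c n f c≤n p with ℕ.m≤n⇒m<n∨m≡n c≤n
  ... | inj₂ refl = refl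
  Σ<-extend c (suc n) f c≤n p | inj₁ (s≤s c≤n′) = trans (Σ<-suc n f)
    (trans (cong (Σ< n f ℕ.+_) (p n c≤n′)) (trans (ℕ.+-identityʳ _) (Σ<-extend c n f c≤n′ p)))

  -- The sum of the first n row lengths a, which completes the area to n C 2 on a
  -- Dyck word.
  coarea : ℕ → Word → ℕ
  coarea n w = Σ< n (λ i → a w (suc i))

  area+coarea : ∀ n w → (∀ y → y < n → a w (suc y) ≤ y) → area n w ℕ.+ coarea n w ≡ n C 2
  area+coarea zero    w rows = refl
  area+coarea (suc n) w rows = begin
    area (suc n) w ℕ.+ coarea (suc n) w    ≡⟨ cong₂ ℕ._+_ (Σ<-suc n _) (Σ<-suc n _) ⟩
    (area n w ℕ.+ (n ∸ r)) ℕ.+ (coarea n w ℕ.+ r) ≡⟨ shuffle (area n w) (n ∸ r) (coarea n w) r ⟩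
    ((n ∸ r) ℕ.+ r) ℕ.+ (area n w ℕ.+ coarea n w)
      ≡⟨ cong₂ ℕ._+_ (ℕ.m∸n+n≡m (rows n ℕ.≤-refl)) (area+coarea n w (λ y q → rows y (ℕ.m≤n⇒m≤1+n q))) ⟩
    n ℕ.+ (n C 2)                          ≡⟨ cong (ℕ._+ (n C 2)) (nC1≡n n) ⟨
    (n C 1) ℕ.+ (n C 2)                    ≡⟨ nCk+nC[k+1]≡[n+1]C[k+1] n 1 ⟩
    suc n C 2                              ∎
    where
    r = a w (suc n)
    shuffle : ∀ x y u v → (x ℕ.+ y) ℕ.+ (u ℕ.+ v) ≡ (y ℕ.+ v) ℕ.+ (x ℕ.+ u)
    shuffle = NS.solve-∀

  coarea-++ : ∀ {m n w} → Ballot m n w → ∀ u → coarea m (w ++ u) ≡ coarea m w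
  coarea-++ {m} b u = Σ<-cong m (λ i i<m → Ballot-a b u (suc i) i<m)

  coarea-north : ∀ {m n w} → Ballot m n w → coarea (suc m) (w ∷ʳ 0F) ≡ coarea m w ℕ.+ n
  coarea-north {m} b = trans (Σ<-suc m _) (cong₂ ℕ._+_ (coarea-++ b _) (Ballot-top b))

  -- A step of the bounce path that does not start at 0 goes strictly down, because
  -- a w j < j.
  bouncePoint-≤ : ∀ {m n w} → Ballot m n w → ∀ j i → j ≤ m → bouncePoint j w i ≤ j ∸ i
  bouncePoint-≤ b j zero    j≤m = ℕ.≤-refl
  bouncePoint-≤ {w = w} b j (suc i) j≤m
    with bouncePoint j w i | bouncePoint-≤ b j i j≤m
  ... | zero  | _ = z≤n
  ... | suc y | q = ℕ.≤-trans (Ballot-rows b y (ℕ.≤-trans q (ℕ.≤-trans (ℕ.m∸n≤m j i) j≤m)))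
    (ℕ.≤-trans (ℕ.pred-mono-≤ q) (ℕ.≤-reflexive (ℕ.pred[m∸n]≡m∸[1+n] j i)))

  bouncePoint-++ : ∀ {m n w} → Ballot m n w → ∀ u j i → j ≤ m → bouncePoint j (w ++ u) i ≡ bouncePoint j w i
  bouncePoint-++ b u j zero    j≤m = refl
  bouncePoint-++ {w = w} b u j (suc i) j≤m = trans (cong (a (w ++ u)) (bouncePoint-++ b u j i j≤m))
    (Ballot-a b u _ (ℕ.≤-trans (bouncePoint-≤ b j i j≤m) (ℕ.≤-trans (ℕ.m∸n≤m j i) j≤m)))

  bounce-++ : ∀ {m n w} → Ballot m n w → ∀ u j → j ≤ m → bounce j (w ++ u) ≡ bounce j w
  bounce-++ b u j j≤m = Σ<-cong j (λ i _ → bouncePoint-++ b u j (suc i) j≤m)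

  bouncePoint-suc : ∀ j w i → bouncePoint j w (suc i) ≡ bouncePoint (a w j) w i
  bouncePoint-suc j w zero    = refl
  bouncePoint-suc j w (suc i) = cong (a w) (bouncePoint-suc j w i)

  -- Started at height m + 1, the bounce path goes west until the abscissa n of the
  -- last north step, and continues from the diagonal at height n.  The sum that defines bounce (suc m) has more terms
  -- than the one for bounce n, but they all vanish.
  bounce-north : ∀ {m n w} → Ballot m n w → bounce (suc m) (w ∷ʳ 0F) ≡ n ℕ.+ bounce n w
  bounce-north {m} {n} {w} b = begin
    Σ< (suc m) (λ i → bouncePoint (suc m) w′ (suc i))
      ≡⟨ Σ<-cong (suc m) (λ i _ → trans (bouncePoint-suc (suc m) w′ i) (cong (λ j → bouncePoint j w′ i) (Ballot-top b))) ⟩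
    Σ< (suc m) (bouncePoint n w′)             ≡⟨ Σ<-first m (bouncePoint n w′) ⟩
    n ℕ.+ Σ< m (λ i → bouncePoint n w′ (suc i))
      ≡⟨ cong (n ℕ.+_) (Σ<-cong m (λ i _ → bouncePoint-++ b _ n (suc i) n≤m)) ⟩
    n ℕ.+ Σ< m (λ i → bouncePoint n w (suc i))
      ≡⟨ cong (n ℕ.+_) (Σ<-extend n m _ n≤m (λ i n≤i → ℕ.n≤0⇒n≡0
           (ℕ.≤-trans (bouncePoint-≤ b n (suc i) n≤m) (ℕ.≤-reflexive (ℕ.m≤n⇒m∸n≡0 (ℕ.m≤n⇒m≤1+n n≤i)))))) ⟩
    n ℕ.+ bounce n w                          ∎
    where
    w′ = w ∷ʳ 0F
    n≤m = Ballot-≤ b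

-- Dyck paths by area and bounce
module DyckPaths {c ℓ} (R : CommutativeRing c ℓ) (z : CommutativeRing.Carrier R) where
  open CommutativeRing R hiding (zero)
  open Codes using (<ᵇ-true; <ᵇ-false)
  open Words
  open Sums R
  open ListSums R
  open Gauss R z
  import Algebra.Properties.Semiring.Exp semiring as Exp
  open Exp using (_^_)
  open import Relation.Binary.Reasoning.Setoid setoid

  -- The sum over the ballot words with m north and n east steps.
  sumBallot : ℕ → ℕ → (Word → Carrier) → Carrier
  sumBallot zero    zero    f = f []
  sumBallot (suc m) zero    f = sumBallot m zero (λ w → f (w ∷ʳ 0F))
  sumBallot zero    (suc n) f = 0#
  sumBallot (suc m) (suc n) f = when (n <ᵇ suc m) (sumBallot (suc m) n (λ w → f (w ∷ʳ 1F)))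
                                + sumBallot m (suc n) (λ w → f (w ∷ʳ 0F))

  sumBallot-cong : ∀ m n {f g : Word → Carrier} → (∀ w → Ballot m n w → f w ≈ g w) →
                   sumBallot m n f ≈ sumBallot m n g
  sumBallot-cong zero    zero    p = p [] []
  sumBallot-cong (suc m) zero    p = sumBallot-cong m zero (λ w b → p _ (north b))
  sumBallot-cong zero    (suc n) p = refl
  sumBallot-cong (suc m) (suc n) {f} {g} p = +-cong
    (easts (n <ᵇ suc m) (ℕ.<ᵇ⇒< n (suc m)))
    (sumBallot-cong m (suc n) (λ w b → p _ (north b)))
    where
    easts : ∀ b → (T b → n < suc m) → when b (sumBallot (suc m) n (λ w → f (w ∷ʳ 1F)))
                                     ≈ when b (sumBallot (suc m) n (λ w → g (w ∷ʳ 1F)))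
    easts true  q = sumBallot-cong (suc m) n (λ w b → p _ (east (q _) b))
    easts false q = refl

  sumBallot-* : ∀ m n x (f : Word → Carrier) → sumBallot m n (λ w → x * f w) ≈ x * sumBallot m n f
  sumBallot-* zero    zero    x f = refl
  sumBallot-* (suc m) zero    x f = sumBallot-* m zero x _
  sumBallot-* zero    (suc n) x f = sym (zeroʳ x)
  sumBallot-* (suc m) (suc n) x f = trans
    (+-cong (trans (when-cong (n <ᵇ suc m) (sumBallot-* (suc m) n x (λ w → f (w ∷ʳ 1F)))) (when-*ˡ (n <ᵇ suc m) x _))
            (sumBallot-* m (suc n) x (λ w → f (w ∷ʳ 0F))))
    (sym (distribˡ x _ _))

  -- There is no ballot word with more east than north steps.
  sumBallot-below : ∀ m n f → m < n → sumBallot m n f ≈ 0#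
  sumBallot-below zero    (suc n) f q = refl
  sumBallot-below (suc m) (suc n) f (s≤s q) = trans
    (+-cong (when-≡ (sumBallot (suc m) n (λ w → f (w ∷ʳ 1F))) (<ᵇ-false q)) (sumBallot-below m (suc n) _ (ℕ.m≤n⇒m≤1+n q)))
    (+-identityˡ _)

  sumBallot-east : ∀ m n f → n ≤ m → sumBallot (suc m) (suc n) f ≈
    sumBallot (suc m) n (λ w → f (w ∷ʳ 1F)) + sumBallot m (suc n) (λ w → f (w ∷ʳ 0F))
  sumBallot-east m n f q = +-congʳ (when-≡ (sumBallot (suc m) n (λ w → f (w ∷ʳ 1F))) (<ᵇ-true (s≤s q)))

  -- The sum over words by their last letters

  words-first : ∀ k (f : Word → Carrier) → sumOver R (words (suc k)) f ≈
    sumOver R (words k) (λ w → f (0F ∷ w)) + sumOver R (words k) (λ w → f (1F ∷ w))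
  words-first k f = trans (sumOver-cartesian _∷_ (allFin 2) (words k) f) (+-congˡ (+-identityʳ _))

  -- All words of the given length are summed, so last letters do as well as first.
  words-last : ∀ k (f : Word → Carrier) → sumOver R (words (suc k)) f ≈
    sumOver R (words k) (λ w → f (w ∷ʳ 0F)) + sumOver R (words k) (λ w → f (w ∷ʳ 1F))
  words-last zero    f = words-first zero f
  words-last (suc k) f = begin
    sumOver R (words (2 ℕ.+ k)) f   ≈⟨ words-first (suc k) f ⟩
    sumOver R (words (suc k)) (λ w → f (0F ∷ w)) + sumOver R (words (suc k)) (λ w → f (1F ∷ w))
      ≈⟨ +-cong (words-last k _) (words-last k _) ⟩
    (_ + _) + (_ + _)               ≈⟨ interchange _ _ _ _ ⟩
    (_ + _) + (_ + _)               ≈⟨ +-cong (words-first k _) (words-first k _) ⟨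
    sumOver R (words (suc k)) (λ w → f (w ∷ʳ 0F)) + sumOver R (words (suc k)) (λ w → f (w ∷ʳ 1F)) ∎

  sumOver-0 : ∀ {A : Set} (xs : List A) → sumOver R xs (λ _ → 0#) ≈ 0#
  sumOver-0 []       = refl
  sumOver-0 (x ∷ xs) = trans (+-identityˡ _) (sumOver-0 xs)

  -- The sum over the ballot words with m north and n east steps among the words
  -- of length k.
  ballotsOf : ℕ → ℕ → ℕ → (Word → Carrier) → Carrier
  ballotsOf k m n f = sumOver R (words k) (λ w → when (does (isBallot? m n w)) (f w))

  none : ∀ k {P : Word → Set} (P? : ∀ w → Dec (P w)) (f : Word → Carrier) → (∀ w → ¬ P w) →
         sumOver R (words k) (λ w → when (does (P? w)) (f w)) ≈ 0#
  none k P? f ¬P = trans (sumOver-cong (words k) (λ w → when-≡ (f w) (dec-false (P? w) (¬P w)))) (sumOver-0 (words k))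

  norths : ∀ k m n (f : Word → Carrier) → sumOver R (words k) (λ w → when (does (isBallot? (suc m) n (w ∷ʳ 0F))) (f (w ∷ʳ 0F)))
           ≈ ballotsOf k m n (λ w → f (w ∷ʳ 0F))
  norths k m n f = sumOver-cong (words k) (λ w → when-≡ (f (w ∷ʳ 0F))
    (does-⇔ (ballot-north⇔ m n w) (isBallot? (suc m) n (w ∷ʳ 0F)) (isBallot? m n w)))

  sumOver-when : ∀ {A : Set} (xs : List A) b (f : A → Carrier) → sumOver R xs (λ x → when b (f x)) ≈ when b (sumOver R xs f)
  sumOver-when xs true  f = refl
  sumOver-when xs false f = sumOver-0 xs

  easts : ∀ k m n (f : Word → Carrier) → sumOver R (words k) (λ w → when (does (isBallot? m (suc n) (w ∷ʳ 1F))) (f (w ∷ʳ 1F)))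
          ≈ when (n <ᵇ m) (ballotsOf k m n (λ w → f (w ∷ʳ 1F)))
  easts k m n f = trans (sumOver-cong (words k) (λ w → trans (when-≡ (f (w ∷ʳ 1F))
    (does-⇔ (ballot-east⇔ m n w) (isBallot? m (suc n) (w ∷ʳ 1F)) ((n ℕ.<? m) ×-dec isBallot? m n w)))
    (when-∧ (n <ᵇ m) (does (isBallot? m n w)) _))) (sumOver-when (words k) (n <ᵇ m) _)

  ballots-correct : ∀ k m n f → m ℕ.+ n ≡ k → ballotsOf k m n f ≈ sumBallot m n f
  ballots-correct zero    zero    zero    f e = +-identityʳ _
  ballots-correct (suc k) (suc m) zero    f e = begin
    ballotsOf (suc k) (suc m) 0 f    ≈⟨ words-last k _ ⟩
    _ + _                            ≈⟨ +-cong (norths k m 0 f) (none k (λ w → isBallot? (suc m) 0 (w ∷ʳ 1F)) (λ w → f (w ∷ʳ 1F)) (east≢0 (suc m))) ⟩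
    ballotsOf k m 0 _ + 0#           ≈⟨ +-identityʳ _ ⟩
    ballotsOf k m 0 _                ≈⟨ ballots-correct k m 0 _ (ℕ.suc-injective e) ⟩
    sumBallot (suc m) 0 f            ∎
  ballots-correct (suc k) zero    (suc n) f e = begin
    ballotsOf (suc k) 0 (suc n) f    ≈⟨ words-last k _ ⟩
    _ + _                            ≈⟨ +-cong (none k (λ w → isBallot? 0 (suc n) (w ∷ʳ 0F)) (λ w → f (w ∷ʳ 0F)) (north≢0 (suc n))) (easts k 0 n f) ⟩
    0# + 0#                          ≈⟨ +-identityˡ _ ⟩
    0#                               ∎
  ballots-correct (suc k) (suc m) (suc n) f e = begin
    ballotsOf (suc k) (suc m) (suc n) f  ≈⟨ words-last k _ ⟩
    _ + _                                ≈⟨ +-cong (norths k m (suc n) f) (easts k (suc m) n f) ⟩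
    ballotsOf k m (suc n) _ + when (n <ᵇ suc m) (ballotsOf k (suc m) n _)
      ≈⟨ +-cong (ballots-correct k m (suc n) _ (ℕ.suc-injective e))
                (when-cong (n <ᵇ suc m) (ballots-correct k (suc m) n _
                  (≡.trans (≡.sym (ℕ.+-suc m n)) (ℕ.suc-injective e)))) ⟩
    sumBallot m (suc n) _ + when (n <ᵇ suc m) (sumBallot (suc m) n _)  ≈⟨ +-comm _ _ ⟩
    sumBallot (suc m) (suc n) f          ∎

  -- The recursion that follows the bounce path

  -- The weight of a word with n rows whose bounce path is started on the diagonal
  -- at height j.
  bounceWeight : ℕ → ℕ → Word → Carrier
  bounceWeight n j w = z^ (coarea n w ℕ.+ bounce j w)

  -- The sum over the ballot words with k + j rows and n east steps.  The bounce
  -- path comes down to row j next, and k rows lie above it.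
  bounceSum : ℕ → ℕ → ℕ → Carrier
  bounceSum k j n = sumBallot (k ℕ.+ j) n (bounceWeight (k ℕ.+ j) j)

  weight-east : ∀ m n j → j ≤ m → ∀ w → Ballot m n w → bounceWeight m j (w ∷ʳ 1F) ≈ bounceWeight m j w
  weight-east m n j j≤m w b = z^≡ (≡.cong₂ ℕ._+_ (coarea-++ b _) (bounce-++ b _ j j≤m))

  weight-north : ∀ m n j → j ≤ m → ∀ w → Ballot m n w → bounceWeight (suc m) j (w ∷ʳ 0F) ≈ z^ n * bounceWeight m j w
  weight-north m n j j≤m w b = trans
    (z^≡ (≡.trans (≡.cong₂ ℕ._+_ (coarea-north b) (bounce-++ b _ j j≤m)) (shuffle (coarea m w) n (bounce j w))))
    (z^+ n _)
    where
    shuffle : ∀ x y u → (x ℕ.+ y) ℕ.+ u ≡ y ℕ.+ (x ℕ.+ u)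
    shuffle = NS.solve-∀

  weight-bounce : ∀ m n w → Ballot m n w → bounceWeight (suc m) (suc m) (w ∷ʳ 0F) ≈ z^ (2 ℕ.* n) * bounceWeight m n w
  weight-bounce m n w b = trans
    (z^≡ (≡.trans (≡.cong₂ ℕ._+_ (coarea-north b) (bounce-north b)) (shuffle (coarea m w) n (bounce n w))))
    (z^+ (2 ℕ.* n) _)
    where
    shuffle : ∀ x y u → (x ℕ.+ y) ℕ.+ (y ℕ.+ u) ≡ 2 ℕ.* y ℕ.+ (x ℕ.+ u)
    shuffle = NS.solve-∀

  bounceSum-above-zero : ∀ k j → bounceSum (suc k) j 0 ≈ bounceSum k j 0
  bounceSum-above-zero k j = trans
    (sumBallot-cong (k ℕ.+ j) 0 (weight-north (k ℕ.+ j) 0 j (ℕ.m≤n+m j k)))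
    (trans (sumBallot-* (k ℕ.+ j) 0 1# (bounceWeight (k ℕ.+ j) j)) (*-identityˡ _))

  -- With k + 1 rows above row j, the last north step only adds n + 1 to the coarea.
  bounceSum-above : ∀ k j n → n < j → bounceSum (suc k) j (suc n) ≈ bounceSum (suc k) j n + z^ (suc n) * bounceSum k j (suc n)
  bounceSum-above k j n n<j = trans (sumBallot-east m n F (ℕ.≤-trans (ℕ.<⇒≤ n<j) j≤m)) (+-cong
    (sumBallot-cong (suc m) n (weight-east (suc m) n j (ℕ.m≤n⇒m≤1+n j≤m)))
    (trans (sumBallot-cong m (suc n) (weight-north m (suc n) j j≤m)) (sumBallot-* m (suc n) (z^ suc n) (bounceWeight m j))))
    where
    m = k ℕ.+ j
    F : Word → Carrier
    F = bounceWeight (suc m) j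
    j≤m : j ≤ m
    j≤m = ℕ.m≤n+m j k

  bounceSum-target-zero : ∀ j → bounceSum 0 (suc j) 0 ≈ bounceSum j 0 0
  bounceSum-target-zero j = begin
    sumBallot j 0 (λ w → bounceWeight (suc j) (suc j) (w ∷ʳ 0F))
      ≈⟨ sumBallot-cong j 0 (weight-bounce j 0) ⟩
    sumBallot j 0 (λ w → 1# * bounceWeight j 0 w)      ≈⟨ sumBallot-* j 0 1# (bounceWeight j 0) ⟩
    1# * sumBallot j 0 (bounceWeight j 0)              ≈⟨ *-identityˡ _ ⟩
    sumBallot j 0 (bounceWeight j 0)
      ≡⟨ ≡.cong (λ m → sumBallot m 0 (bounceWeight m 0)) (ℕ.+-identityʳ j) ⟨
    bounceSum j 0 0                                            ∎

  -- Without rows above row j, a last north step belongs to row j.  The bounce path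
  -- goes on from the diagonal at height n + 1, and n + 1 is added both to the
  -- coarea and to the bounce statistic.
  bounceSum-target : ∀ e n → bounceSum 0 (suc (e ℕ.+ suc n)) (suc n) ≈
             bounceSum 0 (suc (e ℕ.+ suc n)) n + z^ (2 ℕ.* suc n) * bounceSum e (suc n) (suc n)
  bounceSum-target e n = trans (sumBallot-east m n F (ℕ.≤-trans (ℕ.n≤1+n n) (ℕ.m≤n+m (suc n) e))) (+-cong
    (sumBallot-cong (suc m) n (weight-east (suc m) n (suc m) ℕ.≤-refl))
    (trans (sumBallot-cong m (suc n) (weight-bounce m (suc n))) (sumBallot-* m (suc n) (z^ (2 ℕ.* suc n)) (bounceWeight m (suc n)))))
    where
    m = e ℕ.+ suc n
    F : Word → Carrier
    F = bounceWeight (suc m) (suc m)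

  -- A ballot word with n + 1 steps of each kind ends in an east step.
  bounceSum-target-top : ∀ n → bounceSum 0 (suc n) (suc n) ≈ bounceSum 0 (suc n) n
  bounceSum-target-top n = trans (sumBallot-east n n F ℕ.≤-refl) (trans (+-cong
    (sumBallot-cong (suc n) n (weight-east (suc n) n (suc n) ℕ.≤-refl))
    (sumBallot-below n (suc n) (λ w → F (w ∷ʳ 0F)) ℕ.≤-refl)) (+-identityʳ _))
    where
    F : Word → Carrier
    F = bounceWeight (suc n) (suc n)

  -- The value of bounceSum for j = e + n.  The summation index s is the abscissa
  -- of row j: the k rows above it contribute a box partition between s and n, and
  -- the rows below it contribute H.
  bounceForm : ℕ → ℕ → ℕ → Carrier
  bounceForm e k n = conv n (λ s t → z^ ((2 ℕ.+ k) ℕ.* s) * (g k t * H s (t ℕ.+ e)))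

  bounceForm-zero : ∀ e k → bounceForm e k 0 ≈ 1#
  bounceForm-zero e k = begin
    z^ ((2 ℕ.+ k) ℕ.* 0) * (g k 0 * 1#)  ≈⟨ *-cong (z^≡ (ℕ.*-zeroʳ (2 ℕ.+ k))) (*-congʳ (g-zeroʳ k)) ⟩
    1# * (1# * 1#)                       ≈⟨ trans (*-identityˡ _) (*-identityˡ _) ⟩
    1#                                   ∎

  H-≡ : ∀ s {k k′} → k ≡ k′ → H s k ≈ H s k′
  H-≡ s e = reflexive (≡.cong (H s) e)

  bounceForm-above : ∀ e k n → bounceForm e (suc k) (suc n) ≈ bounceForm (suc e) (suc k) n + z^ (suc n) * bounceForm e k (suc n)
  bounceForm-above e k n = begin
    bounceForm e (suc k) (suc n)                         ≈⟨ conv-last n (F′ e) ⟩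
    conv n (λ s t → F′ e s (suc t)) + F′ e (suc n) 0  ≈⟨ +-cong (conv-cong n step) top ⟩
    conv n (λ s t → F′ (suc e) s t + zⁿ * F s (suc t)) + zⁿ * F (suc n) 0
      ≈⟨ +-congʳ (trans (conv-+ n _ _) (+-congˡ (conv-* n zⁿ _))) ⟩
    (bounceForm (suc e) (suc k) n + zⁿ * conv n (λ s t → F s (suc t))) + zⁿ * F (suc n) 0
      ≈⟨ solve 4 (λ b x u v → (b :+ x :* u) :+ x :* v := b :+ x :* (u :+ v)) refl _ _ _ _ ⟩
    bounceForm (suc e) (suc k) n + zⁿ * (conv n (λ s t → F s (suc t)) + F (suc n) 0)
      ≈⟨ +-congˡ (*-congˡ (conv-last n F)) ⟨
    bounceForm (suc e) (suc k) n + zⁿ * bounceForm e k (suc n)    ∎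
    where
    F : ℕ → ℕ → Carrier
    F s t = z^ ((2 ℕ.+ k) ℕ.* s) * (g k t * H s (t ℕ.+ e))
    F′ : ℕ → ℕ → ℕ → Carrier
    F′ e s t = z^ ((3 ℕ.+ k) ℕ.* s) * (g (suc k) t * H s (t ℕ.+ e))
    zⁿ : Carrier
    zⁿ = z^ (suc n)

    expo : ∀ s t k → (3 ℕ.+ k) ℕ.* s ℕ.+ suc t ≡ suc (s ℕ.+ t) ℕ.+ (2 ℕ.+ k) ℕ.* s
    expo = NS.solve-∀

    shift : ∀ s t → s ℕ.+ t ≡ n → z^ ((3 ℕ.+ k) ℕ.* s) * z^ (suc t) ≈ zⁿ * z^ ((2 ℕ.+ k) ℕ.* s)
    shift s t ≡.refl = trans (sym (z^+ ((3 ℕ.+ k) ℕ.* s) (suc t)))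
      (trans (z^≡ (expo s t k)) (z^+ (suc n) ((2 ℕ.+ k) ℕ.* s)))

    step : ∀ s t → s ℕ.+ t ≡ n → F′ e s (suc t) ≈ F′ (suc e) s t + zⁿ * F s (suc t)
    step s t s+t≡n = begin
      X * (g (suc k) (suc t) * H s (suc t ℕ.+ e))     ≈⟨ *-congˡ (*-congʳ (pascal₂ k t)) ⟩
      X * ((z^ (suc t) * g k (suc t) + g (suc k) t) * H s (suc t ℕ.+ e))
        ≈⟨ solve 5 (λ x y u v h → x :* ((y :* u :+ v) :* h) := x :* (v :* h) :+ (x :* y) :* (u :* h)) refl X _ _ _ _ ⟩
      X * (g (suc k) t * H s (suc t ℕ.+ e)) + (X * z^ (suc t)) * (g k (suc t) * H s (suc t ℕ.+ e))
        ≈⟨ +-cong (*-congˡ (*-congˡ (H-≡ s (≡.sym (ℕ.+-suc t e)))))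
                  (trans (*-congʳ (shift s t s+t≡n)) (*-assoc _ _ _)) ⟩
      F′ (suc e) s t + zⁿ * F s (suc t)               ∎
      where
      X : Carrier
      X = z^ ((3 ℕ.+ k) ℕ.* s)

    top : F′ e (suc n) 0 ≈ zⁿ * F (suc n) 0
    top = trans (*-cong (z^+ (suc n) ((2 ℕ.+ k) ℕ.* suc n)) (*-congʳ (sym (g-zeroʳ k)))) (*-assoc _ _ _)

  bounceForm-target : ∀ e n → bounceForm e 0 (suc n) ≈ bounceForm (suc e) 0 n + z^ (2 ℕ.* suc n) * H (suc n) e
  bounceForm-target e n = trans (conv-last n (λ s t → z^ (2 ℕ.* s) * (1# * H s (t ℕ.+ e)))) (+-cong
    (conv-cong n (λ s t _ → *-congˡ (*-congˡ (H-≡ s (≡.sym (ℕ.+-suc t e))))))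
    (*-congˡ (*-identityˡ _)))

  -- For e = 0 the convolution is complete.
  bounceForm-diagonal : ∀ k n → bounceForm 0 k n ≈ H n (suc k)
  bounceForm-diagonal k n = trans
    (conv-cong n (λ s t _ → *-congˡ (*-congˡ (H-≡ s (ℕ.+-identityʳ t)))))
    (H-recursion n k)

  bounceSum-≡ : ∀ k {j j′} n → j ≡ j′ → bounceSum k j n ≈ bounceSum k j′ n
  bounceSum-≡ k n e = reflexive (≡.cong (λ j → bounceSum k j n) e)

  -- By induction on the number of rows, bounded by N, and on n.  In the case of
  -- k = 0 and j = n + 1, the two sides match because H (n + 1) 0 = 0.
  bounceSum-closed : ∀ N k e n → k ℕ.+ (e ℕ.+ n) ≤ N → bounceSum k (e ℕ.+ n) n ≈ bounceForm e k n
  bounceSum-closed N zero zero zero q = sym (bounceForm-zero 0 0)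
  bounceSum-closed (suc N) zero (suc e) zero (s≤s q) = begin
    bounceSum 0 (suc (e ℕ.+ 0)) 0    ≈⟨ bounceSum-target-zero (e ℕ.+ 0) ⟩
    bounceSum (e ℕ.+ 0) 0 0          ≈⟨ bounceSum-closed N (e ℕ.+ 0) 0 0 (ℕ.≤-trans (ℕ.≤-reflexive (ℕ.+-identityʳ (e ℕ.+ 0))) q) ⟩
    bounceForm 0 (e ℕ.+ 0) 0          ≈⟨ trans (bounceForm-zero 0 (e ℕ.+ 0)) (sym (bounceForm-zero (suc e) 0)) ⟩
    bounceForm (suc e) 0 0            ∎
  bounceSum-closed (suc N) (suc k) e zero (s≤s q) = begin
    bounceSum (suc k) (e ℕ.+ 0) 0    ≈⟨ bounceSum-above-zero k (e ℕ.+ 0) ⟩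
    bounceSum k (e ℕ.+ 0) 0          ≈⟨ bounceSum-closed N k e 0 q ⟩
    bounceForm e k 0                  ≈⟨ trans (bounceForm-zero e k) (sym (bounceForm-zero e (suc k))) ⟩
    bounceForm e (suc k) 0            ∎
  bounceSum-closed N zero zero (suc n) q = begin
    bounceSum 0 (suc n) (suc n)      ≈⟨ bounceSum-target-top n ⟩
    bounceSum 0 (suc n) n            ≈⟨ bounceSum-closed N 0 1 n q ⟩
    bounceForm 1 0 n                  ≈⟨ +-identityʳ _ ⟨
    bounceForm 1 0 n + 0#             ≈⟨ +-congˡ (trans (*-congˡ (H-zero n)) (zeroʳ _)) ⟨
    bounceForm 1 0 n + z^ (2 ℕ.* suc n) * H (suc n) 0  ≈⟨ bounceForm-target 0 n ⟨
    bounceForm 0 0 (suc n)            ∎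
  bounceSum-closed (suc N) zero (suc e) (suc n) (s≤s q) = begin
    bounceSum 0 (suc (e ℕ.+ suc n)) (suc n)     ≈⟨ bounceSum-target e n ⟩
    bounceSum 0 (suc (e ℕ.+ suc n)) n + z^ (2 ℕ.* suc n) * bounceSum e (suc n) (suc n)
      ≈⟨ +-cong (trans (bounceSum-≡ 0 n (≡.cong suc (ℕ.+-suc e n)))
                  (bounceSum-closed (suc N) 0 (2 ℕ.+ e) n (s≤s (ℕ.≤-trans (ℕ.≤-reflexive (≡.sym (ℕ.+-suc e n))) q))))
                (*-congˡ (trans (bounceSum-closed N e 0 (suc n) q) (bounceForm-diagonal e (suc n)))) ⟩
    bounceForm (2 ℕ.+ e) 0 n + z^ (2 ℕ.* suc n) * H (suc n) (suc e)  ≈⟨ bounceForm-target (suc e) n ⟨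
    bounceForm (suc e) 0 (suc n)                 ∎
  bounceSum-closed (suc N) (suc k) e (suc n) (s≤s q) = begin
    bounceSum (suc k) (e ℕ.+ suc n) (suc n)     ≈⟨ bounceSum-above k (e ℕ.+ suc n) n (ℕ.m≤n+m (suc n) e) ⟩
    bounceSum (suc k) (e ℕ.+ suc n) n + z^ (suc n) * bounceSum k (e ℕ.+ suc n) (suc n)
      ≈⟨ +-cong (trans (bounceSum-≡ (suc k) n (ℕ.+-suc e n))
                  (bounceSum-closed (suc N) (suc k) (suc e) n
                    (s≤s (ℕ.≤-trans (ℕ.≤-reflexive (≡.cong (k ℕ.+_) (≡.sym (ℕ.+-suc e n)))) q))))
                (*-congˡ (bounceSum-closed N k e (suc n) q)) ⟩
    bounceForm (suc e) (suc k) n + z^ (suc n) * bounceForm e k (suc n) ≈⟨ bounceForm-above e k n ⟨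
    bounceForm e (suc k) (suc n)                 ∎

  Cat-closed : ∀ n q → q * z ≈ 1# → Cat R n q z ≈ q ^ (n C 2) * H n 1
  Cat-closed n q qz = begin
    Cat R n q z                ≈⟨ sumOver-filter (isDyck? n) (words (2 ℕ.* n)) _ ⟩
    ballotsOf (2 ℕ.* n) n n (λ w → q ^ area n w * z^ bounce n w)
      ≈⟨ ballots-correct (2 ℕ.* n) n n _ (≡.cong (n ℕ.+_) (≡.sym (ℕ.+-identityʳ n))) ⟩
    sumBallot n n (λ w → q ^ area n w * z^ bounce n w)
      ≈⟨ sumBallot-cong n n term ⟩
    sumBallot n n (λ w → q ^ (n C 2) * bounceWeight n n w)  ≈⟨ sumBallot-* n n (q ^ (n C 2)) (bounceWeight n n) ⟩
    q ^ (n C 2) * bounceSum 0 n n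
      ≈⟨ *-congˡ (trans (bounceSum-closed n 0 0 n ℕ.≤-refl) (bounceForm-diagonal 0 n)) ⟩
    q ^ (n C 2) * H n 1       ∎
    where
    term : ∀ w → Ballot n n w → q ^ area n w * z^ bounce n w ≈ q ^ (n C 2) * bounceWeight n n w
    term w b = begin
      q ^ area n w * z^ bounce n w        ≈⟨ *-congʳ (z^-complement qz (area n w) (coarea n w)) ⟩
      q ^ (area n w ℕ.+ coarea n w) * z^ coarea n w * z^ bounce n w   ≈⟨ *-assoc _ _ _ ⟩
      q ^ (area n w ℕ.+ coarea n w) * (z^ coarea n w * z^ bounce n w)
        ≈⟨ *-cong (Exp.^-congʳ q (area+coarea n w (Ballot-rows b))) (sym (z^+ (coarea n w) _)) ⟩
      q ^ (n C 2) * bounceWeight n n w    ∎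

mainTheorem5 : ∀ {c ℓ} (R : CommutativeRing c ℓ) → let open CommutativeRing R in
    ∀ (n : ℕ) → 1 ≤ n → ∀ (q q⁻¹ : Carrier) → q * q⁻¹ ≈ 1# → 𝒜 R n q q⁻¹ ≈ Cat R n q q⁻¹
mainTheorem5 R n _ q q⁻¹ qq⁻¹≈1 =
  trans (𝒜-closed n q qq⁻¹≈1) (sym (Cat-closed n q qq⁻¹≈1))
  where
  open CommutativeRing R using (trans; sym)
  open Permutations R q⁻¹ using (𝒜-closed)
  open DyckPaths R q⁻¹ using (Cat-closed)
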